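{- Let $k\geq 3$ and $n\ge1$. There is a bijection $\Phi$ from the set $\mathcal{S}_n(F_k)$ of permutations of $[n]$ avoiding $F_k=2\,3\,\cdots\,k\,1$ to the set $\mathcal{S}_n(H_k,Q_k)$ of permutations of $[n]$ avoiding both $H_k$ and $Q_k$, such that $\mathcal{D}(\Phi(\pi))=\mathcal{D}(\pi)$ for every $\pi\in\mathcal{S}_n(F_k)$.
   Context: For $\pi=\pi_1\cdots\pi_n$ a permutation of $[n]$, $\mathcal{D}(\pi)=\{i:\pi_i>\pi_{i+1}\}$ is its descent set. A subsequence $\pi_{i_1}\cdots\pi_{i_k}$ ($i_1<\cdots<i_k$) is order-isomorphic to a pattern $\tau$ if its entries appear in the same relative order as $\tau$; $\pi$ avoids $\tau$ if no such subsequence exists. Let $J_k=12\cdots k$ and $G_k=1\,2\cdots(k-2)\,k\,(k-1)$. We say $\pi$ contains an occurrence of $H_k$ if there exist indices $i_1<\cdots<i_k$ such that $\pi_{i_1}\cdots\pi_{i_k}$ is order-isomorphic to $J_k$ and there exists $j\in\mathcal{D}(\pi)$ with $i_{k-1}\le j<i_k$; otherwise $\pi$ avoids $H_k$. We say $\pi$ contains an occurrence of $Q_k$ if there exist indices $i_1<\cdots<i_k$ such that $\pi_{i_1}\cdots\pi_{i_k}$ is order-isomorphic to $G_k$ and $\pi_{i_{k-1}}<\pi_{i_{k-1}+1}<\cdots<\pi_{i_k-1}>\pi_{i_k}$; otherwise $\pi$ avoids $Q_k$. $\mathcal{S}_n(H_k,Q_k)$ is the set of permutations of $[n]$ avoiding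 both $H_k$ and $Q_k$. -}

module Defs where

open import Data.Nat using (ℕ; zero; suc; _+_; _∸_; _<_; _≤_; _≡ᵇ_)
open import Data.Nat.Properties using (<-trans; n<1+n)
open import Data.Bool using (if_then_else_)
open import Data.Fin using (Fin; toℕ; fromℕ<)
open import Data.Fin.Permutation using (Permutation′; _⟨$⟩ʳ_)
open import Data.Product using (Σ; _×_; ∃; ∃-syntax)
open import Relation.Binary.PropositionalEquality using (_≡_)
open import Relation.Nullary using (¬_)

-- A permutation of [n] (positions and values are 0-indexed via Fin n;
-- only the relative order matters for everything below).
Perm : ℕ → Set
Perm n = Permutation′ n

val : ∀ {n} → Perm n → Fin n → ℕ
val π i = toℕ (π ⟨$⟩ʳ i)

Descent : ∀ {n} → Perm n → ℕ → Set
Descent {n} π j = Σ (suc j < n) λ p → val π (fromℕ< p) < val π (fromℕ< (<-trans (n<1+n j) p))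

Ascent : ∀ {n} → Perm n → ℕ → Set
Ascent {n} π j = Σ (suc j < n) λ p → val π (fromℕ< (<-trans (n<1+n j) p)) < val π (fromℕ< p)

-- A pattern of length k, given by its sequence of (distinct) values.
Pattern : ℕ → Set
Pattern k = Fin k → ℕ

StrictIncr : ∀ {k n} → (Fin k → Fin n) → Set
StrictIncr {k} f = ∀ (a b : Fin k) → toℕ a < toℕ b → toℕ (f a) < toℕ (f b)

OrderIso : ∀ {k n} → Pattern k → Perm n → (Fin k → Fin n) → Set
OrderIso {k} τ π f = ∀ (a b : Fin k) →
  (τ a < τ b → val π (f a) < val π (f b)) × (val π (f a) < val π (f b) → τ a < τ b)

Occurrence : ∀ {k n} → Pattern k → Perm n → (Fin k → Fin n) → Set
Occurrence τ π f = StrictIncr f × OrderIso τ π f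

Contains : ∀ {k n} → Pattern k → Perm n → Set
Contains {k} {n} τ π = ∃[ f ] Occurrence {k} {n} τ π f

Avoids : ∀ {k n} → Pattern k → Perm n → Set
Avoids τ π = ¬ Contains τ π

-- Patterns (1-indexed values, positions a : Fin k with toℕ a = 0..k-1).
-- F_k = 2 3 ... k 1
F : (k : ℕ) → Pattern k
F k a = if (toℕ a + 1 ≡ᵇ k) then 1 else toℕ a + 2

J : (k : ℕ) → Pattern k
J k a = toℕ a + 1

G : (k : ℕ) → Pattern k
G k a = if (toℕ a + 2 ≡ᵇ k) then k else (if (toℕ a + 1 ≡ᵇ k) then k ∸ 1 else toℕ a + 1)

ContainsH : (k : ℕ) → ∀ {n} → Perm n → Set
ContainsH k {n} π = Σ (Fin k → Fin n) λ f → Occurrence (J k) π f ×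
  (Σ (Fin k) λ a → Σ (Fin k) λ b → (toℕ a + 2 ≡ k) × (toℕ b + 1 ≡ k) ×
    (∃[ j ] (Descent π j × (toℕ (f a) ≤ j) × (j < toℕ (f b)))))

AvoidsH : (k : ℕ) → ∀ {n} → Perm n → Set
AvoidsH k π = ¬ ContainsH k π

ContainsQ : (k : ℕ) → ∀ {n} → Perm n → Set
ContainsQ k {n} π = Σ (Fin k → Fin n) λ f → Occurrence (G k) π f ×
  (Σ (Fin k) λ a → Σ (Fin k) λ b → (toℕ a + 2 ≡ k) × (toℕ b + 1 ≡ k) ×
    ((∀ j → toℕ (f a) ≤ j → suc j < toℕ (f b) → Ascent π j) ×
     Descent π (toℕ (f b) ∸ 1)))

AvoidsQ : (k : ℕ) → ∀ {n} → Perm n → Set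
AvoidsQ k π = ¬ ContainsQ k π

_≈ₚ_ : ∀ {n} → Perm n → Perm n → Set
_≈ₚ_ {n} π σ = ∀ (i : Fin n) → π ⟨$⟩ʳ i ≡ σ ⟨$⟩ʳ i

{-# OPTIONS --safe #-}

-- A permutation is fed, through its Lehmer code, into a reversible insertion on
-- standard Young tableaux: for (H_k, Q_k) the code counts the earlier smaller
-- entries and the insertion is by rows, for F_k it counts the earlier larger
-- entries and the insertion is by columns.  By Schensted's theorem, avoidance says
-- the same thing on both sides: at each descent the tableau is cut at its first
-- cell in column k - 1, the entries from there on are frozen, the next entry lies
-- below the frozen ones, and if something was cut then the new cell is not the
-- first cell removed.  Descents are read off from the relative position of
-- consecutive new cells.  Since an insertion can be undone from the tableau and
-- the position of its new cell, a permutation amounts to the final tableau together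
-- with the new cells and the pieces cut off; these data obey the same conditions on
-- both sides, so keeping them and exchanging rows with columns is the bijection.

module Submission where

open import Defs
open import Algebra.Properties.CommutativeSemigroup using (interchange)
open import Data.Bool using (if_then_else_; true; false)
open import Data.Empty using (⊥; ⊥-elim)
open import Data.Fin using (Fin; toℕ; fromℕ; fromℕ<; inject₁; punchIn; opposite)
import Data.Fin as Fin
open import Data.Fin.Permutation using (_⟨$⟩ʳ_; _⟨$⟩ˡ_; id; insert; remove; punchIn-permute; remove-insert; _∘ₚ_; reverse; inverseˡ)
open import Data.Fin.Properties using (toℕ-fromℕ; toℕ-inject₁; toℕ<n; toℕ-injective; toℕ-fromℕ<; fromℕ<-toℕ; opposite-prop; opposite-involutive)
open import Data.List using (List; []; _∷_; _++_; length; map)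
open import Data.List.Properties using (++-assoc; ++-identityʳ; ∷-injective)
open import Data.List.Relation.Unary.All using (All; []; _∷_)
open import Data.List.Relation.Unary.AllPairs using (AllPairs; []; _∷_)
open import Data.Nat using (ℕ; zero; suc; _+_; _∸_; _⊔_; _≤_; _<_; _>_; z≤n; s≤s; z<s; _≟_; _≤?_; _<?_; _≡ᵇ_)
open import Data.Nat.Properties
open import Data.Product using (Σ; _×_; _,_; proj₁; proj₂; ∃-syntax; ∃₂)
open import Data.Sum using (_⊎_; inj₁; inj₂; [_,_]′)
import Data.Sum as Sum
open import Data.Unit using (⊤; tt)
open import Function using (_∘_)
open import Function.Bundles using (_⇔_; mk⇔)
open import Relation.Binary.Definitions using (tri<; tri≈; tri>)
open import Relation.Binary.PropositionalEquality using (_≡_; _≢_; refl; sym; trans; cong; cong₂; subst; subst₂)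
open import Relation.Nullary using (¬_; yes; no; contradiction)

-- Lattice words and insertion

-- `Ins` is one line of a Fomin growth diagram: it reads the tableau from the smallest entry upward,
-- so entries above a cut never influence later insertions, and freezing them is dropping a prefix
-- of the word. Column insertion is the same relation applied to the complemented permutation. The
-- descent in H_k has a counterpart in F_k: a rise of k - 1 entries followed by a smaller entry has
-- a descent in between. The obstacle is the step at a cut: the last new cell may be gone, so
-- consecutive new cells no longer show whether the step was a descent, and the two sides satisfy
-- the cut conditions for different reasons. By rows the descent follows from the place of the last
-- entry, while a new cell equal to the first removed one is an occurrence of Q_k. By columns such a
-- new cell would force an ascent, so at a descent its exclusion is automatic; conversely, once it
-- is excluded, the step has to be a descent. Both facts are needed because transposing recovers the
-- codes from the cells alone.

opaque
  cnt : List ℕ → ℕ → ℕ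
  cnt [] i = 0
  cnt (c ∷ w) i with c ≟ i
  ... | yes _ = suc (cnt w i)
  ... | no _ = cnt w i

  cnt-[] : ∀ i → cnt [] i ≡ 0
  cnt-[] i = refl

  cnt-hit : ∀ c w → cnt (c ∷ w) c ≡ suc (cnt w c)
  cnt-hit c w with c ≟ c
  ... | yes _ = refl
  ... | no c≢c = contradiction refl c≢c

  cnt-miss : ∀ {c i} w → c ≢ i → cnt (c ∷ w) i ≡ cnt w i
  cnt-miss {c} {i} w c≢i with c ≟ i
  ... | yes c≡i = contradiction c≡i c≢i
  ... | no _ = refl

  cnt-≤-∷ : ∀ c w i → cnt w i ≤ cnt (c ∷ w) i
  cnt-≤-∷ c w i with c ≟ i
  ... | yes _ = n≤1+n _
  ... | no _ = ≤-refl

  cnt-∷-cong : ∀ c {w w′ i} → cnt w i ≡ cnt w′ i → cnt (c ∷ w) i ≡ cnt (c ∷ w′) i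
  cnt-∷-cong c {i = i} eq with c ≟ i
  ... | yes _ = cong suc eq
  ... | no _ = eq

cnt-swap : ∀ b c w i → cnt (b ∷ c ∷ w) i ≡ cnt (c ∷ b ∷ w) i
cnt-swap b c w i with b ≟ c | b ≟ i
... | yes refl | _ = refl
... | no b≢c | yes refl rewrite cnt-hit b (c ∷ w) | cnt-miss (b ∷ w) (b≢c ∘ sym) | cnt-hit b w | cnt-miss w (b≢c ∘ sym) = refl
... | no _ | no b≢i rewrite cnt-miss (c ∷ w) b≢i = cnt-∷-cong c (sym (cnt-miss w b≢i))

Addable : ℕ → List ℕ → Set
Addable c w = ∀ {p} → p < c → cnt w c < cnt w p

-- A word lists, from the largest entry of a tableau down to the smallest, the row
-- of each entry; the condition says that the entries up to any value form a shape.
data Yam : List ℕ → Set where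
  [] : Yam []
  _∷_ : ∀ {c w} → Addable c w → Yam w → Yam (c ∷ w)

Yam-antitone : ∀ {w p q} → Yam w → p ≤ q → cnt w q ≤ cnt w p
Yam-antitone {q = q} [] _ = ≤-trans (≤-reflexive (cnt-[] q)) z≤n
Yam-antitone {c ∷ w} {p} {q} (a ∷ y) p≤q with c ≟ q
... | no c≢q rewrite cnt-miss w c≢q = ≤-trans (Yam-antitone y p≤q) (cnt-≤-∷ c w p)
... | yes refl rewrite cnt-hit c w with p ≟ q
...   | yes refl = ≤-reflexive (sym (cnt-hit p w))
...   | no p≢q = ≤-trans (a (≤∧≢⇒< p≤q p≢q)) (cnt-≤-∷ c w p)

Yam-++⁻ʳ : ∀ E {w} → Yam (E ++ w) → Yam w
Yam-++⁻ʳ [] y = y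
Yam-++⁻ʳ (c ∷ E) (_ ∷ y) = Yam-++⁻ʳ E y

-- Ins w g w′ ρ: a new entry with g smaller entries is inserted into row 0; going
-- through the larger entries, the first one in row 0 is bumped to row 1, the next
-- one in row 1 to row 2, and so on; ρ is the row where the shape grows.
data Ins : List ℕ → ℕ → List ℕ → ℕ → Set where
  here : ∀ {w} → Ins w (length w) (0 ∷ w) 0
  skip : ∀ {c w g w′ ρ} → c ≢ ρ → Ins w g w′ ρ → Ins (c ∷ w) g (c ∷ w′) ρ
  bump : ∀ {w g w′ ρ} → Ins w g w′ ρ → Ins (ρ ∷ w) g (suc ρ ∷ w′) (suc ρ)

Ins-gap≤ : ∀ {w g w′ ρ} → Ins w g w′ ρ → g ≤ length w
Ins-gap≤ here = ≤-refl
Ins-gap≤ (skip _ i) = m≤n⇒m≤1+n (Ins-gap≤ i)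
Ins-gap≤ (bump i) = m≤n⇒m≤1+n (Ins-gap≤ i)

Ins-length : ∀ {w g w′ ρ} → Ins w g w′ ρ → length w′ ≡ suc (length w)
Ins-length here = refl
Ins-length (skip _ i) = cong suc (Ins-length i)
Ins-length (bump i) = cong suc (Ins-length i)

Ins-total : ∀ w {g} → g ≤ length w → ∃₂ λ w′ ρ → Ins w g w′ ρ
Ins-total [] z≤n = _ , _ , here
Ins-total (c ∷ w) {g} g≤ with g ≟ suc (length w)
... | yes refl = _ , _ , here
... | no g≢ with Ins-total w (≤-pred (≤∧≢⇒< g≤ g≢))
...   | w′ , ρ , i with c ≟ ρ
...     | yes refl = _ , _ , bump i
...     | no c≢ρ = _ , _ , skip c≢ρ i

Ins-functional : ∀ {w g w₁ w₂ ρ₁ ρ₂} → Ins w g w₁ ρ₁ → Ins w g w₂ ρ₂ → w₁ ≡ w₂ × ρ₁ ≡ ρ₂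
Ins-functional here here = refl , refl
Ins-functional here (skip _ j) = contradiction (Ins-gap≤ j) 1+n≰n
Ins-functional here (bump j) = contradiction (Ins-gap≤ j) 1+n≰n
Ins-functional (skip _ i) here = contradiction (Ins-gap≤ i) 1+n≰n
Ins-functional (bump i) here = contradiction (Ins-gap≤ i) 1+n≰n
Ins-functional (skip _ i) (skip _ j) with Ins-functional i j
... | refl , refl = refl , refl
Ins-functional (skip c≢ i) (bump j) with Ins-functional i j
... | _ , refl = contradiction refl c≢
Ins-functional (bump i) (skip c≢ j) with Ins-functional i j
... | _ , refl = contradiction refl c≢
Ins-functional (bump i) (bump j) with Ins-functional i j
... | refl , _ = refl , refl

Ins-injective : ∀ {w₁ w₂ g₁ g₂ w ρ} → Ins w₁ g₁ w ρ → Ins w₂ g₂ w ρ → w₁ ≡ w₂ × g₁ ≡ g₂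
Ins-injective here here = refl , refl
Ins-injective here (skip c≢ _) = contradiction refl c≢
Ins-injective (skip c≢ _) here = contradiction refl c≢
Ins-injective (skip _ i) (skip _ j) with Ins-injective i j
... | refl , refl = refl , refl
Ins-injective (skip c≢ _) (bump _) = contradiction refl c≢
Ins-injective (bump _) (skip c≢ _) = contradiction refl c≢
Ins-injective (bump i) (bump j) with Ins-injective i j
... | refl , refl = refl , refl

Ins-cnt : ∀ {w g w′ ρ} → Ins w g w′ ρ → ∀ i → cnt w′ i ≡ cnt (ρ ∷ w) i
Ins-cnt here i = refl
Ins-cnt (skip {c} {w} {ρ = ρ} _ p) i = trans (cnt-∷-cong c (Ins-cnt p i)) (cnt-swap c ρ w i)
Ins-cnt (bump {ρ = ρ} p) i = cnt-∷-cong (suc ρ) (Ins-cnt p i)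

Addable-cong : ∀ {c w w′} → (∀ i → cnt w i ≡ cnt w′ i) → Addable c w → Addable c w′
Addable-cong {c} eq a {p} p<c = subst (_< _) (eq c) (subst (cnt _ c <_) (eq p) (a p<c))

Addable-∷ : ∀ {b c w} → b ≢ c → Addable c w → Addable c (b ∷ w)
Addable-∷ {b} {c} {w} b≢c a {p} p<c rewrite cnt-miss w b≢c = <-≤-trans (a p<c) (cnt-≤-∷ b w p)

Addable-suc : ∀ {c w} → Yam w → Addable c w → Addable (suc c) (c ∷ w)
Addable-suc {c} {w} y a {p} p<sc rewrite cnt-miss {c} {suc c} w (<⇒≢ ≤-refl) with p ≟ c
... | yes refl rewrite cnt-hit p w = s≤s (Yam-antitone y (n≤1+n p))
... | no p≢c = <-≤-trans (≤-<-trans (Yam-antitone y (n≤1+n c)) (a (≤∧≢⇒< (≤-pred p<sc) p≢c))) (cnt-≤-∷ c w p)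

-- The two conclusions are proved together: an entry bumped to row `suc ρ` fits there because row
-- `ρ` was addable before it grew.
Ins-Yam : ∀ {w g w′ ρ} → Yam w → Ins w g w′ ρ → Yam w′ × Addable ρ w
Ins-Yam y here = (λ ()) ∷ y , λ ()
Ins-Yam (a ∷ y) (skip c≢ i) with Ins-Yam y i
... | y′ , b = Addable-cong (λ j → sym (Ins-cnt i j)) (Addable-∷ (λ e → c≢ (sym e)) a) ∷ y′ , Addable-∷ c≢ b
Ins-Yam (a ∷ y) (bump i) with Ins-Yam y i
... | y′ , b = Addable-cong (λ j → sym (Ins-cnt i j)) (Addable-suc y b) ∷ y′ , Addable-suc y b

-- The hypothesis says that row `ρ` ends in a corner. If the largest entry lies in row `ρ`, it is
-- the inserted entry when `ρ` is 0 and was bumped out of the previous row otherwise; its own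
-- addability is then the corner condition for that previous row.
Ins-reverse : ∀ {w ρ} → Yam w → cnt w (suc ρ) < cnt w ρ → ∃₂ λ w₀ g → Ins w₀ g w ρ × Yam w₀
Ins-reverse {[]} {ρ} _ rem = contradiction (subst (cnt [] (suc ρ) <_) (cnt-[] ρ) rem) n≮0
Ins-reverse {c ∷ w} {ρ} (a ∷ y) rem with c ≟ ρ
Ins-reverse {c ∷ w} {zero} (a ∷ y) rem | yes refl = w , _ , here , y
Ins-reverse {c ∷ w} {suc p} (a ∷ y) rem | yes refl with Ins-reverse y (a ≤-refl)
... | w₀ , g , i , y₀ = p ∷ w₀ , g , bump i , (λ {q} → b {q}) ∷ y₀
  where
  b : Addable p w₀
  b {q} q<p = begin-strict
    cnt w₀ p <⟨ ≤-reflexive (sym (trans (Ins-cnt i p) (cnt-hit p w₀))) ⟩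
    cnt w p  ≤⟨ Yam-antitone y (<⇒≤ q<p) ⟩
    cnt w q  ≡⟨ trans (Ins-cnt i q) (cnt-miss w₀ (>⇒≢ q<p)) ⟩
    cnt w₀ q ∎ where open ≤-Reasoning
Ins-reverse {c ∷ w} {ρ} (a ∷ y) rem | no c≢ρ with Ins-reverse y (subst (cnt w (suc ρ) <_) (cnt-miss w c≢ρ) (≤-<-trans (cnt-≤-∷ c w (suc ρ)) rem))
... | w₀ , g , i , y₀ = c ∷ w₀ , g , skip c≢ρ i , (λ {q} → b {q}) ∷ y₀
  where
  rem′ : cnt (c ∷ w) (suc ρ) < cnt w ρ
  rem′ = subst (cnt (c ∷ w) (suc ρ) <_) (cnt-miss w c≢ρ) rem
  eq : ∀ {j} → ρ ≢ j → cnt w j ≡ cnt w₀ j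
  eq {j} ρ≢j = trans (Ins-cnt i j) (cnt-miss w₀ ρ≢j)
  b : Addable c w₀
  b {q} q<c with ρ ≟ q
  ... | no ρ≢q = subst (_< cnt w₀ q) (eq (λ e → c≢ρ (sym e))) (subst (cnt w c <_) (eq ρ≢q) (a q<c))
  ... | yes refl = begin-strict
    cnt w₀ c            ≡⟨ sym (eq (λ e → c≢ρ (sym e))) ⟩
    cnt w c             <⟨ ≤-reflexive (sym (cnt-hit c w)) ⟩
    cnt (c ∷ w) c       ≤⟨ Yam-antitone (a ∷ y) q<c ⟩
    cnt (c ∷ w) (suc ρ) ≤⟨ ≤-pred (subst (cnt (c ∷ w) (suc ρ) <_) (trans (Ins-cnt i ρ) (cnt-hit ρ w₀)) rem′) ⟩
    cnt w₀ ρ            ∎ where open ≤-Reasoning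

-- Row bumping lemma. When the first carry moves to `suc ρ`, the entry that it moves lands in that
-- row, so a second carry already at `suc ρ` is pushed on in turn and stays strictly ahead.
bump-lo : ∀ {w g w₁ ρ g′ w₂ ρ′} → Ins w g w₁ ρ → Ins w₁ g′ w₂ ρ′ → g′ ≤ g → ρ < ρ′
bump-lo here here le = contradiction le 1+n≰n
bump-lo here (skip 0≢ρ _) _ = n≢0⇒n>0 (λ e → 0≢ρ (sym e))
bump-lo here (bump _) _ = z<s
bump-lo (skip _ i) here le = contradiction (≤-trans (≤-reflexive (sym (cong suc (Ins-length i)))) (≤-trans le (m≤n⇒m≤1+n (Ins-gap≤ i)))) 1+n≰n
bump-lo (bump i) here le = contradiction (≤-trans (≤-reflexive (sym (cong suc (Ins-length i)))) (≤-trans le (m≤n⇒m≤1+n (Ins-gap≤ i)))) 1+n≰n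
bump-lo (skip _ i) (skip _ j) le = bump-lo i j le
bump-lo (skip _ i) (bump j) le = m≤n⇒m≤1+n (bump-lo i j le)
bump-lo (bump i) (skip ≢ j) le = ≤∧≢⇒< (bump-lo i j le) ≢
bump-lo (bump i) (bump j) le = ≤-refl

bump-hi : ∀ {w g w₁ ρ g′ w₂ ρ′} → Ins w g w₁ ρ → Ins w₁ g′ w₂ ρ′ → g < g′ → ρ′ ≤ ρ
bump-hi _ here _ = z≤n
bump-hi here (skip _ j) lt = contradiction (<-≤-trans lt (Ins-gap≤ j)) 1+n≰n
bump-hi here (bump j) lt = contradiction (<-≤-trans lt (Ins-gap≤ j)) 1+n≰n
bump-hi (skip _ i) (skip _ j) lt = bump-hi i j lt
bump-hi (skip ≢ i) (bump j) lt = ≤∧≢⇒< (bump-hi i j lt) ≢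
bump-hi (bump i) (skip _ j) lt = m≤n⇒m≤1+n (bump-hi i j lt)
bump-hi (bump i) (bump j) lt = contradiction (bump-hi i j lt) 1+n≰n

-- Conjugate shapes

record Conj (R C : List ℕ) : Set where
  constructor conj
  field
    row⇒col   : ∀ {i j} → j < cnt R i → i < cnt C j
    col⇒row : ∀ {i j} → i < cnt C j → j < cnt R i
open Conj

Conj-[] : Conj [] []
Conj-[] .row⇒col {i} lt = contradiction (subst (_ <_) (cnt-[] i) lt) n≮0
Conj-[] .col⇒row {j = j} lt = contradiction (subst (_ <_) (cnt-[] j) lt) n≮0

Conj-sym : ∀ {R C} → Conj R C → Conj C R
Conj-sym κ = conj (col⇒row κ) (row⇒col κ)

Conj-resp : ∀ {R R′ C C′} → (∀ i → cnt R i ≡ cnt R′ i) → (∀ i → cnt C i ≡ cnt C′ i) → Conj R C → Conj R′ C′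
Conj-resp p q κ .row⇒col {i} {j} lt = subst (i <_) (q j) (row⇒col κ (subst (j <_) (sym (p i)) lt))
Conj-resp p q κ .col⇒row {i} {j} lt = subst (j <_) (p i) (col⇒row κ (subst (i <_) (sym (q j)) lt))

Conj-count : ∀ {R C ρ} → Conj R C → Addable ρ R → cnt C (cnt R ρ) ≡ ρ
Conj-count κ a = ≤-antisym
  (≮⇒≥ λ lt → n≮n _ (col⇒row κ lt))
  (≮⇒≥ λ lt → n≮n _ (row⇒col κ (a lt)))

Conj-Addable : ∀ {R C ρ} → Conj R C → Addable ρ R → Addable (cnt R ρ) C
Conj-Addable {C = C} κ a {j} lt = subst (_< cnt C j) (sym (Conj-count κ a)) (row⇒col κ lt)

private
  ∷-to : ∀ {R C ρ γ} → γ ≡ cnt R ρ → ρ ≡ cnt C γ → Conj R C →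
         ∀ {i j} → j < cnt (ρ ∷ R) i → i < cnt (γ ∷ C) j
  ∷-to {R} {C} {ρ} {γ} p q κ {i} {j} lt with ρ ≟ i | γ ≟ j
  ... | yes refl | yes refl rewrite cnt-hit γ C = s≤s (≤-reflexive q)
  ... | yes refl | no γ≢j rewrite cnt-hit ρ R | cnt-miss C γ≢j =
        row⇒col κ (≤∧≢⇒< (≤-pred lt) λ e → γ≢j (trans p (sym e)))
  ... | no ρ≢i | yes refl rewrite cnt-hit γ C | cnt-miss R ρ≢i = m≤n⇒m≤1+n (row⇒col κ lt)
  ... | no ρ≢i | no γ≢j rewrite cnt-miss R ρ≢i | cnt-miss C γ≢j = row⇒col κ lt

  ∷⁻-to : ∀ {R C ρ γ} → γ ≡ cnt R ρ → ρ ≡ cnt C γ → Conj (ρ ∷ R) (γ ∷ C) →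
          ∀ {i j} → j < cnt R i → i < cnt C j
  ∷⁻-to {R} {C} {ρ} {γ} p q κ {i} {j} lt with row⇒col κ (<-≤-trans lt (cnt-≤-∷ ρ R i)) | γ ≟ j
  ... | lt′ | no γ≢j = subst (i <_) (cnt-miss C γ≢j) lt′
  ... | lt′ | yes refl with ρ ≟ i
  ...   | yes refl = contradiction p (<⇒≢ lt)
  ...   | no ρ≢i = ≤∧≢⇒< (≤-pred (subst (i <_) (cnt-hit γ C) lt′)) λ e → ρ≢i (trans q (sym e))

Conj-∷ : ∀ {R C ρ γ} → γ ≡ cnt R ρ → ρ ≡ cnt C γ → Conj R C → Conj (ρ ∷ R) (γ ∷ C)
Conj-∷ p q κ = conj (∷-to p q κ) (∷-to q p (Conj-sym κ))

Conj-∷⁻ : ∀ {R C ρ γ} → γ ≡ cnt R ρ → ρ ≡ cnt C γ → Conj (ρ ∷ R) (γ ∷ C) → Conj R C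
Conj-∷⁻ p q κ = conj (∷⁻-to p q κ) (∷⁻-to q p (Conj-sym κ))

-- The cell in row `ρ` and column `cnt R ρ` is a corner of the enlarged shape, so reverse insertion
-- from it applies to any tableau `C₁` of the transposed shape and leaves one of the transposed old
-- shape.
Conj-Ins⁻ : ∀ {R C₁ ρ} → Yam R → Addable ρ R → Yam C₁ → Conj (ρ ∷ R) C₁ →
            ∃₂ λ C g → Ins C g C₁ (cnt R ρ) × Yam C × Conj R C × cnt C (cnt R ρ) ≡ ρ
Conj-Ins⁻ {R} {C₁} {ρ} yR aρ yC κ = C , g , i , yC₀ , Conj-∷⁻ refl (sym eq) (Conj-resp (λ _ → refl) (Ins-cnt i) κ) , eq
  where
  γ = cnt R ρ
  top : cnt C₁ γ ≡ suc ρ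
  top = ≤-antisym
    (≮⇒≥ λ lt → n≮n γ (<-≤-trans (subst (γ <_) (cnt-miss R (<⇒≢ ≤-refl)) (col⇒row κ lt)) (Yam-antitone yR (n≤1+n ρ))))
    (row⇒col κ (≤-reflexive (sym (cnt-hit ρ R))))
  rem : cnt C₁ (suc γ) < cnt C₁ γ
  rem = subst (cnt C₁ (suc γ) <_) (sym top) (s≤s (≮⇒≥ λ lt → n≮n _ (subst (suc γ <_) (cnt-hit ρ R) (col⇒row κ lt))))
  rev = Ins-reverse yC rem
  C = proj₁ rev
  g = proj₁ (proj₂ rev)
  i = proj₁ (proj₂ (proj₂ rev))
  yC₀ = proj₂ (proj₂ (proj₂ rev))
  eq : cnt C γ ≡ ρ
  eq = suc-injective (trans (sym (trans (Ins-cnt i γ) (cnt-hit γ C))) top)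

-- The columns of the cells that E adds to Q.
skew : List ℕ → List ℕ → List ℕ
skew [] Q = []
skew (c ∷ E) Q = cnt (E ++ Q) c ∷ skew E Q

skew-Conj : ∀ E {Q Q′} → Yam (E ++ Q) → Yam Q′ → Conj Q Q′ →
            Yam (skew E Q ++ Q′) × Conj (E ++ Q) (skew E Q ++ Q′) × E ≡ skew (skew E Q) Q′
skew-Conj [] _ y′ κ = y′ , κ , refl
skew-Conj (c ∷ E) (a ∷ y) y′ κ with skew-Conj E y y′ κ
... | y″ , κ′ , eq =
  (λ {_} → Conj-Addable κ′ a) ∷ y″ , Conj-∷ refl (sym (Conj-count κ′ a)) κ′ , cong₂ _∷_ (sym (Conj-count κ′ a)) eq

Addable-unique : ∀ {w p q} → Addable p w → Addable q w → cnt w p ≡ cnt w q → p ≡ q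
Addable-unique a b eq = ≤-antisym
  (≮⇒≥ λ lt → <⇒≢ (a lt) eq)
  (≮⇒≥ λ lt → <⇒≢ (b lt) (sym eq))

Conj-start : ∀ {C} → Yam C → Conj (0 ∷ []) C → C ≡ 0 ∷ []
Conj-start {[]} _ κ = contradiction (subst (0 <_) (cnt-[] 0) (row⇒col κ {0} {0} (subst (0 <_) (sym (cnt-hit 0 [])) z<s))) n≮0
Conj-start {c ∷ C} (a ∷ y) κ = start C y κ (low (col⇒row κ {0} {c} (subst (0 <_) (sym (cnt-hit c C)) z<s)))
  where
  start₀ : cnt (0 ∷ []) 0 ≡ 1
  start₀ = trans (cnt-hit 0 []) (cong suc (cnt-[] 0))
  low : ∀ {j} → j < cnt (0 ∷ []) 0 → j ≡ 0
  low {j} lt = n<1⇒n≡0 (subst (j <_) start₀ lt)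
  start : ∀ {c} C → Yam C → Conj (0 ∷ []) (c ∷ C) → c ≡ 0 → c ∷ C ≡ 0 ∷ []
  start [] _ _ refl = refl
  start (b ∷ C) y κ refl = contradiction (subst (0 <_) (trans (cnt-miss [] (λ ())) (cnt-[] 1)) (col⇒row κ {1} {0} two)) n≮0
    where
    two : 1 < cnt (0 ∷ b ∷ C) 0
    two = subst (1 <_) (sym (cnt-hit 0 (b ∷ C))) (s≤s (<-≤-trans (subst (0 <_) (sym (cnt-hit b C)) z<s) (Yam-antitone y z≤n)))


-- Runs

-- With κ = k - 3: side `rows κ` is (H_k, Q_k), where letters are rows, and side
-- `cols κ` is F_k, where letters are columns and the same insertion is by columns.
-- The cell (letter X , height X) is the first cell of column k - 1.
data Side : Set where
  rows cols : ℕ → Side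

letter height : Side → ℕ
letter (rows κ) = 0
letter (cols κ) = suc κ
height (rows κ) = suc κ
height (cols κ) = 0

dual : Side → Side
dual (rows κ) = cols κ
dual (cols κ) = rows κ

height≡letter-dual : ∀ X → height X ≡ letter (dual X)
height≡letter-dual (rows _) = refl
height≡letter-dual (cols _) = refl

letter≡height-dual : ∀ X → letter X ≡ height (dual X)
letter≡height-dual (rows _) = refl
letter≡height-dual (cols _) = refl

-- Where ties go depends on the code: the previous entry is among the earlier smaller ones exactly
-- at an ascent, and among the earlier larger ones exactly at a descent.
Asc Desc : Side → ℕ → ℕ → Set
Asc (rows _) e e′ = e < e′
Asc (cols _) e e′ = e′ ≤ e
Desc (rows _) e e′ = e′ ≤ e
Desc (cols _) e e′ = e < e′

asc? : ∀ X e e′ → Asc X e e′ ⊎ Desc X e e′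
asc? (rows _) e e′ with e <? e′
... | yes lt = inj₁ lt
... | no ≮ = inj₂ (≮⇒≥ ≮)
asc? (cols _) e e′ with e <? e′
... | yes lt = inj₂ lt
... | no ≮ = inj₁ (≮⇒≥ ≮)

asc-desc : ∀ X {e e′} → Asc X e e′ → Desc X e e′ → ⊥
asc-desc (rows _) lt le = <⇒≱ lt le
asc-desc (cols _) le lt = <⇒≱ lt le

-- The comparisons of codes serve for letters too, with the roles exchanged: an insertion further to
-- the right in value ends in an earlier letter.
bump-asc : ∀ X {w g w₁ ρ g′ w₂ ρ′} → Ins w g w₁ ρ → Ins w₁ g′ w₂ ρ′ → Asc X g g′ → Desc X ρ ρ′
bump-asc (rows _) = bump-hi
bump-asc (cols _) = bump-lo

bump-desc : ∀ X {w g w₁ ρ g′ w₂ ρ′} → Ins w g w₁ ρ → Ins w₁ g′ w₂ ρ′ → Desc X g g′ → Asc X ρ ρ′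
bump-desc (rows _) = bump-lo
bump-desc (cols _) = bump-hi

bump-asc⁻ : ∀ X {w g w₁ ρ g′ w₂ ρ′} → Ins w g w₁ ρ → Ins w₁ g′ w₂ ρ′ → Desc X ρ ρ′ → Asc X g g′
bump-asc⁻ X {g = g} {g′ = g′} i j d with asc? X g g′
... | inj₁ a = a
... | inj₂ d′ = ⊥-elim (asc-desc X (bump-desc X i j d′) d)

bump-desc⁻ : ∀ X {w g w₁ ρ g′ w₂ ρ′} → Ins w g w₁ ρ → Ins w₁ g′ w₂ ρ′ → Asc X ρ ρ′ → Desc X g g′
bump-desc⁻ X {g = g} {g′ = g′} i j a with asc? X g g′
... | inj₁ a′ = ⊥-elim (asc-desc X a (bump-asc X i j a′))
... | inj₂ d = d

private
  box-≤ : ∀ {R ρ γ ρ₁} → Yam R → cnt R ρ ≡ suc γ → ρ₁ ≤ ρ → γ < cnt R ρ₁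
  box-≤ y eq le = ≤-trans (≤-reflexive (sym eq)) (Yam-antitone y le)

  box-> : ∀ {R ρ γ ρ₁} → Addable ρ₁ R → cnt R ρ ≡ suc γ → ρ < ρ₁ → cnt R ρ₁ ≤ γ
  box-> {R} {ρ₁ = ρ₁} a eq lt = ≤-pred (subst (cnt R ρ₁ <_) eq (a lt))

-- The last new cell ends its row `ρ`, so for the next new cell weakly higher is the same as
-- strictly further right. Exchanging rows and columns thus also exchanges strict and weak
-- comparison, as the two bumping lemmas require.
box-asc : ∀ X {R ρ γ ρ₁} → Yam R → Addable ρ₁ R → cnt R ρ ≡ suc γ → Desc X ρ ρ₁ → Desc (dual X) γ (cnt R ρ₁)
box-asc (rows _) y a = box-≤ y
box-asc (cols _) y a = box-> a

box-desc : ∀ X {R ρ γ ρ₁} → Yam R → Addable ρ₁ R → cnt R ρ ≡ suc γ → Asc X ρ ρ₁ → Asc (dual X) γ (cnt R ρ₁)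
box-desc (rows _) y a = box-> a
box-desc (cols _) y a = box-≤ y

-- The first two indices are the Lehmer code, latest entry first.
data Run (X : Side) : ℕ → List ℕ → List ℕ → ℕ → Set where
  start : Run X 0 [] (0 ∷ []) 0
  asc : ∀ {e es R ρ e′ R₁ ρ₁} → Run X e es R ρ → Asc X e e′ →
        Ins R e′ R₁ ρ₁ → Run X e′ (e ∷ es) R₁ ρ₁
  small : ∀ {e es R ρ e′ R₁ ρ₁} → Run X e es R ρ → Desc X e e′ →
          cnt R (letter X) ≤ height X → Ins R e′ R₁ ρ₁ → Run X e′ (e ∷ es) R₁ ρ₁
  cut : ∀ {e es R ρ e′ R₁ ρ₁} E {Q} → Run X e es R ρ → Desc X e e′ →
        R ≡ E ++ letter X ∷ Q → cnt Q (letter X) ≡ height X →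
        Ins Q e′ R₁ ρ₁ → ρ₁ ≢ letter X → Run X e′ (e ∷ es) R₁ ρ₁

-- Cutting a word and restricting an insertion to its lower part

cnt-++-≤ : ∀ E w i → cnt w i ≤ cnt (E ++ w) i
cnt-++-≤ [] w i = ≤-refl
cnt-++-≤ (c ∷ E) w i = ≤-trans (cnt-++-≤ E w i) (cnt-≤-∷ c (E ++ w) i)

cnt-cut : ∀ E c w → cnt w c < cnt (E ++ c ∷ w) c
cnt-cut E c w = <-≤-trans (≤-reflexive (sym (cnt-hit c w))) (cnt-++-≤ E (c ∷ w) c)

cut-unique : ∀ E E′ {c w w′} → E ++ c ∷ w ≡ E′ ++ c ∷ w′ → cnt w c ≡ cnt w′ c → E ≡ E′ × w ≡ w′
cut-unique [] [] refl _ = refl , refl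
cut-unique [] (_ ∷ E′) {c} {w′ = w′} refl eq = contradiction (sym eq) (<⇒≢ (cnt-cut E′ c w′))
cut-unique (_ ∷ E) [] {c} {w} refl eq = contradiction eq (<⇒≢ (cnt-cut E c w))
cut-unique (_ ∷ E) (_ ∷ E′) p eq with ∷-injective p
... | refl , q with cut-unique E E′ q eq
...   | refl , refl = refl , refl

length-++-≤ : ∀ (F : List ℕ) R → length R ≤ length (F ++ R)
length-++-≤ [] R = ≤-refl
length-++-≤ (_ ∷ F) R = m≤n⇒m≤1+n (length-++-≤ F R)

-- The carry runs from smaller to larger entries only, so an insertion restricts to every lower
-- segment that contains the new entry.
Ins-above : ∀ {w g w′ ρ} → Ins w g w′ ρ → ∀ F′ {R′} → w′ ≡ F′ ++ R′ → g < length R′ →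
            ∃[ F ] ∃[ R ] ∃[ ρ₀ ] (w ≡ F ++ R × Ins R g R′ ρ₀)
Ins-above i [] refl _ = [] , _ , _ , refl , i
Ins-above here (_ ∷ F′) {R′} refl lt = contradiction (<-≤-trans lt (length-++-≤ F′ R′)) (n≮n _)
Ins-above (skip {c} _ i) (_ ∷ F′) refl lt with Ins-above i F′ refl lt
... | F , R , ρ₀ , refl , j = c ∷ F , R , ρ₀ , refl , j
Ins-above (bump {ρ = c} i) (_ ∷ F′) refl lt with Ins-above i F′ refl lt
... | F , R , ρ₀ , refl , j = c ∷ F , R , ρ₀ , refl , j

Ins-below : ∀ {w g w′ ρ} → Ins w g w′ ρ → ∀ F′ {R′} → w′ ≡ F′ ++ R′ → length R′ ≤ g → ∃[ F ] w ≡ F ++ R′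
Ins-below i [] refl le = contradiction (≤-trans (≤-reflexive (sym (Ins-length i))) (≤-trans le (Ins-gap≤ i))) 1+n≰n
Ins-below here (_ ∷ F′) refl _ = F′ , refl
Ins-below (skip {c} _ i) (_ ∷ F′) refl le with Ins-below i F′ refl le
... | F , refl = c ∷ F , refl
Ins-below (bump {ρ = c} i) (_ ∷ F′) refl le with Ins-below i F′ refl le
... | F , refl = c ∷ F , refl

Ins-at : ∀ {w g w′ ρ} → Ins w g w′ ρ → ∀ F {c R} → w′ ≡ F ++ c ∷ R → g ≡ length R → c ≡ 0
Ins-at here [] refl _ = refl
Ins-at here (_ ∷ F) {c} {R} refl eq = contradiction (≤-trans (length-++-≤ F (c ∷ R)) (≤-reflexive eq)) 1+n≰n
Ins-at (skip _ i) [] refl refl = contradiction (≤-trans (≤-reflexive (sym (Ins-length i))) (Ins-gap≤ i)) 1+n≰n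
Ins-at (bump i) [] refl refl = contradiction (≤-trans (≤-reflexive (sym (Ins-length i))) (Ins-gap≤ i)) 1+n≰n
Ins-at (skip _ i) (_ ∷ F) refl eq = Ins-at i F refl eq
Ins-at (bump i) (_ ∷ F) refl eq = Ins-at i F refl eq

Ins-cnt-≤ : ∀ {w g w′ ρ} → Ins w g w′ ρ → ∀ i → cnt w i ≤ cnt w′ i
Ins-cnt-≤ {w} {ρ = ρ} p i = ≤-trans (cnt-≤-∷ ρ w i) (≤-reflexive (sym (Ins-cnt p i)))

Run-last : ∀ {X e es R ρ} → Run X e es R ρ → ∃[ R⁻ ] (Ins R⁻ e R ρ × Yam R⁻)
Run-Yam : ∀ {X e es R ρ} → Run X e es R ρ → Yam R
Run-last start = [] , here , []
Run-last (asc r _ i) = _ , i , Run-Yam r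
Run-last (small r _ _ i) = _ , i , Run-Yam r
Run-last (cut E r _ refl _ i _) with Yam-++⁻ʳ E (Run-Yam r)
... | _ ∷ y = _ , i , y
Run-Yam r = let _ , i , y = Run-last r in proj₁ (Ins-Yam y i)

-- No entry is ever bumped into row 0, so an entry of row 0 above the new one was already there;
-- since it was not bumped, the carry below it had left row 0, and the count of row 0 below it is
-- unchanged.
zero-above : ∀ {w g w′ ρ E Q} → Ins w g w′ ρ → w′ ≡ E ++ 0 ∷ Q → g < length Q →
             ∃[ E₀ ] ∃[ Q₀ ] (w ≡ E₀ ++ 0 ∷ Q₀ × length Q ≡ suc (length Q₀) × cnt Q₀ 0 ≡ cnt Q 0)
zero-above {E = E} i eq lt with Ins-above i E eq (m≤n⇒m≤1+n lt)
... | E₀ , _ , _ , eq₀ , here = contradiction lt (n≮n _)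
... | E₀ , _ , _ , eq₀ , skip {w = Q₀} 0≢ρ j = E₀ , Q₀ , eq₀ , Ins-length j ,
      sym (trans (Ins-cnt j 0) (cnt-miss Q₀ λ e → 0≢ρ (sym e)))

-- The last entry is not below the entry at the cut. Otherwise `zero-above` finds the same cut
-- before the last insertion. That contradicts a descent, after which column k - 1 was empty or had
-- just been cut away; an ascent only raises the bound known from the step before.
Run-rows-cut : ∀ {κ e es R ρ} → Run (rows κ) e es R ρ → ∀ E {Q} → R ≡ E ++ 0 ∷ Q → cnt Q 0 ≡ suc κ → length Q ≤ e
Run-rows-cut start [] refl _ = z≤n
Run-rows-cut start (_ ∷ []) () _
Run-rows-cut start (_ ∷ _ ∷ _) () _
Run-rows-cut (asc {e′ = e′} r lt i) E {Q} eq cq with length Q ≤? e′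
... | yes le = le
... | no ≰ with zero-above {E = E} i eq (≰⇒> ≰)
...   | E₀ , Q₀ , eq₀ , len , c₀ = ≤-trans (≤-reflexive len) (≤-<-trans (Run-rows-cut r E₀ eq₀ (trans c₀ cq)) lt)
Run-rows-cut (small {e′ = e′} r _ sm i) E {Q} eq cq with length Q ≤? e′
... | yes le = le
... | no ≰ with zero-above {E = E} i eq (≰⇒> ≰)
...   | E₀ , Q₀ , refl , _ , c₀ =
        contradiction sm (<⇒≱ (≤-<-trans (≤-reflexive (sym (trans c₀ cq))) (cnt-cut E₀ 0 Q₀)))
Run-rows-cut (cut {e′ = e′} _ r _ _ cq₀ i _) E {Q} eq cq with length Q ≤? e′
... | yes le = le
... | no ≰ with zero-above {E = E} i eq (≰⇒> ≰)
...   | E₀ , Q₀ , refl , _ , c₀ = contradiction (trans (trans c₀ cq) (sym cq₀)) (<⇒≢ (cnt-cut E₀ 0 Q₀))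

no-room : ∀ {κ Q g R₁ ρ₁} → Yam Q → cnt Q (suc κ) ≡ 0 → Ins Q g R₁ ρ₁ → suc κ < ρ₁ → ⊥
no-room {ρ₁ = ρ₁} y c₀ i lt = n≮0 (subst (cnt _ ρ₁ <_) c₀ (proj₂ (Ins-Yam y i) lt))

-- The new entry has letter 0 and every entry that is not bumped keeps its letter, so a first letter
-- `suc κ` comes from a bump out of column `κ`; below that bump the insertion ended in column `κ`.
fresh-letter : ∀ {κ w g w′ ρ} → cnt w (suc κ) ≡ 0 → Ins w g w′ ρ → ∀ E {Q} → w′ ≡ E ++ suc κ ∷ Q →
               ∃[ Q⁻ ] Ins Q⁻ g Q κ
fresh-letter {κ} {w} {g} c₀ i E {Q} eq with <-cmp g (length Q)
... | tri≈ _ g≡ _ = contradiction (Ins-at i E eq g≡) λ ()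
... | tri> _ _ g> with Ins-below i E eq g>
...   | F , refl = contradiction (subst (_ <_) c₀ (cnt-cut F (suc κ) Q)) n≮0
fresh-letter {κ} {w} {g} c₀ i E {Q} eq | tri< g< _ _ with Ins-above i E eq (m≤n⇒m≤1+n g<)
... | _ , _ , _ , refl , bump j = _ , j
... | F , _ , _ , refl , skip {w = Q₀} _ j = contradiction (subst (_ <_) c₀ (cnt-cut F (suc κ) Q₀)) n≮0

-- Seen on the part Q that is kept, the last insertion ended in column κ, the bump
-- into column suc κ being what created the entry at the cut.
Run-cols-cut : ∀ {κ e es R ρ} → Run (cols κ) e es R ρ → ∀ E {Q} → R ≡ E ++ suc κ ∷ Q → cnt Q (suc κ) ≡ 0 →
               ∃[ Q⁻ ] Ins Q⁻ e Q κ
Run-cols-cut start [] () _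
Run-cols-cut start (_ ∷ []) () _
Run-cols-cut start (_ ∷ _ ∷ _) () _
Run-cols-cut (small r _ sm i) E eq _ = fresh-letter (n≤0⇒n≡0 sm) i E eq
Run-cols-cut (cut _ r _ _ c₀ i _) E eq _ = fresh-letter c₀ i E eq
Run-cols-cut (asc {e′ = e′} r le i) E {Q} eq cq with <-cmp e′ (length Q)
... | tri≈ _ g≡ _ = contradiction (Ins-at i E eq g≡) λ ()
... | tri> _ _ g> with Ins-below i E eq g>
...   | F , eq₀ with Run-cols-cut r F eq₀ cq
...     | Q⁻ , j = contradiction (≤-trans (≤-trans g> le) (Ins-gap≤ j)) (<⇒≱ (m≤n⇒m≤1+n (≤-reflexive (sym (Ins-length j)))))
Run-cols-cut {κ} (asc {e′ = e′} r le i) E {Q} eq cq | tri< g< _ _ with Ins-above i E eq (m≤n⇒m≤1+n g<)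
... | _ , _ , _ , _ , bump j = _ , j
... | F , _ , _ , refl , skip {w = Q₀} ≢ρ j with n≤0⇒n≡0 (≤-trans (Ins-cnt-≤ j (suc κ)) (≤-reflexive cq))
...   | c₀ with Run-cols-cut r F refl c₀ | Yam-++⁻ʳ F (Run-Yam r)
...     | _ , j₀ | _ ∷ y = ⊥-elim (no-room y c₀ j (≤∧≢⇒< (bump-lo j₀ j le) ≢ρ))

-- By rows, the new entry goes below the cut and the last entry is not below it. By columns, the
-- last insertion, seen on `Q`, ended in column `κ`; at an ascent the new cell would lie further on,
-- but `suc κ` is excluded and beyond it there is no room.
cut-desc : ∀ X {e es R ρ E Q e′ R₁ ρ₁} → Run X e es R ρ → R ≡ E ++ letter X ∷ Q → cnt Q (letter X) ≡ height X →
           Ins Q e′ R₁ ρ₁ → ρ₁ ≢ letter X → Desc X e e′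
cut-desc (rows _) {E = E} r eq cq i _ = ≤-trans (Ins-gap≤ i) (Run-rows-cut r E eq cq)
cut-desc (cols _) {e} {E = E} {e′ = e′} r refl cq i ≢ with Run-cols-cut r E refl cq | Yam-++⁻ʳ E (Run-Yam r) | e <? e′
... | _ | _ | yes lt = lt
... | _ , j | _ ∷ y | no ≮ = ⊥-elim (no-room y cq i (≤∧≢⇒< (bump-lo j i (≮⇒≥ ≮)) λ e → ≢ (sym e)))


-- Runs on both sides with the same new cells and the same pieces cut off.

data Joint (X Y : Side) : ℕ → List ℕ → List ℕ → ℕ → ℕ → List ℕ → List ℕ → ℕ → Set where
  start : Joint X Y 0 [] (0 ∷ []) 0 0 [] (0 ∷ []) 0
  asc : ∀ {e es R ρ e′ R₁ ρ₁ d ds C γ d′ C₁ γ₁} → Joint X Y e es R ρ d ds C γ →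
        Asc X e e′ → Asc Y d d′ → Ins R e′ R₁ ρ₁ → Ins C d′ C₁ γ₁ →
        γ₁ ≡ cnt R ρ₁ → ρ₁ ≡ cnt C γ₁ →
        Joint X Y e′ (e ∷ es) R₁ ρ₁ d′ (d ∷ ds) C₁ γ₁
  small : ∀ {e es R ρ e′ R₁ ρ₁ d ds C γ d′ C₁ γ₁} → Joint X Y e es R ρ d ds C γ →
          Desc X e e′ → Desc Y d d′ →
          cnt R (letter X) ≤ height X → cnt C (letter Y) ≤ height Y →
          Ins R e′ R₁ ρ₁ → Ins C d′ C₁ γ₁ → γ₁ ≡ cnt R ρ₁ → ρ₁ ≡ cnt C γ₁ →
          Joint X Y e′ (e ∷ es) R₁ ρ₁ d′ (d ∷ ds) C₁ γ₁
  cut : ∀ {e es R ρ e′ R₁ ρ₁ d ds C γ d′ C₁ γ₁} E {Q} E′ {Q′} → Joint X Y e es R ρ d ds C γ →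
        Desc X e e′ → Desc Y d d′ →
        R ≡ E ++ letter X ∷ Q → C ≡ E′ ++ letter Y ∷ Q′ →
        cnt Q (letter X) ≡ height X → cnt Q′ (letter Y) ≡ height Y →
        E′ ≡ skew E (letter X ∷ Q) → E ≡ skew E′ (letter Y ∷ Q′) →
        Ins Q e′ R₁ ρ₁ → Ins Q′ d′ C₁ γ₁ → ρ₁ ≢ letter X → γ₁ ≢ letter Y →
        γ₁ ≡ cnt Q ρ₁ → ρ₁ ≡ cnt Q′ γ₁ →
        Joint X Y e′ (e ∷ es) R₁ ρ₁ d′ (d ∷ ds) C₁ γ₁

Joint-sym : ∀ {X Y e es R ρ d ds C γ} → Joint X Y e es R ρ d ds C γ → Joint Y X d ds C γ e es R ρ
Joint-sym start = start
Joint-sym (asc J a b i j p q) = asc (Joint-sym J) b a j i q p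
Joint-sym (small J a b s t i j p q) = small (Joint-sym J) b a t s j i q p
Joint-sym (cut E E′ J a b r c rq cq s t i j m n p q) = cut E′ E (Joint-sym J) b a c r cq rq t s j i n m q p

Joint-Run : ∀ {X Y e es R ρ d ds C γ} → Joint X Y e es R ρ d ds C γ → Run X e es R ρ
Joint-Run start = start
Joint-Run (asc J a _ i _ _ _) = asc (Joint-Run J) a i
Joint-Run (small J a _ s _ i _ _ _) = small (Joint-Run J) a s i
Joint-Run (cut E _ J a _ r _ rq _ _ _ i _ m _ _ _) = cut E (Joint-Run J) a r rq i m

Joint-box : ∀ {X Y e es R ρ d ds C γ} → Joint X Y e es R ρ d ds C γ → cnt R ρ ≡ suc γ
Joint-box start = trans (cnt-hit 0 []) (cong suc (cnt-[] 0))
Joint-box (asc {R = R} {ρ₁ = ρ₁} _ _ _ i _ p _) = trans (Ins-cnt i ρ₁) (trans (cnt-hit ρ₁ R) (cong suc (sym p)))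
Joint-box (small {R = R} {ρ₁ = ρ₁} _ _ _ _ _ i _ p _) = trans (Ins-cnt i ρ₁) (trans (cnt-hit ρ₁ R) (cong suc (sym p)))
Joint-box (cut {ρ₁ = ρ₁} E {Q} _ _ _ _ _ _ _ _ _ _ i _ _ _ p _) = trans (Ins-cnt i ρ₁) (trans (cnt-hit ρ₁ Q) (cong suc (sym p)))

Run-functional : ∀ {X e es R ρ R′ ρ′} → Run X e es R ρ → Run X e es R′ ρ′ → R ≡ R′ × ρ ≡ ρ′
Run-functional start start = refl , refl
Run-functional (asc r _ i) (asc r′ _ i′) with Run-functional r r′
... | refl , _ = Ins-functional i i′
Run-functional {X} (asc _ a _) (small _ b _ _) = ⊥-elim (asc-desc X a b)
Run-functional {X} (asc _ a _) (cut _ _ b _ _ _ _) = ⊥-elim (asc-desc X a b)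
Run-functional {X} (small _ b _ _) (asc _ a _) = ⊥-elim (asc-desc X a b)
Run-functional {X} (cut _ _ b _ _ _ _) (asc _ a _) = ⊥-elim (asc-desc X a b)
Run-functional (small r _ _ i) (small r′ _ _ i′) with Run-functional r r′
... | refl , _ = Ins-functional i i′
Run-functional {X} (small r _ s _) (cut E {Q} r′ _ refl c _ _) with Run-functional r r′
... | refl , _ = contradiction s (<⇒≱ (≤-<-trans (≤-reflexive (sym c)) (cnt-cut E (letter X) Q)))
Run-functional {X} (cut E {Q} r′ _ refl c _ _) (small r _ s _) with Run-functional r r′
... | refl , _ = contradiction s (<⇒≱ (≤-<-trans (≤-reflexive (sym c)) (cnt-cut E (letter X) Q)))
Run-functional (cut E r _ p c i _) (cut E′ r′ _ p′ c′ i′ _) with Run-functional r r′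
... | refl , _ with cut-unique E E′ (trans (sym p) p′) (trans c (sym c′))
...   | refl , refl = Ins-functional i i′

-- The code on side `X` fixes the shapes and the cuts, and through `Joint-box` the new cells, so the
-- insertions into `C` can be undone one at a time, each in only one way. At a cut, the tableau
-- before it is rebuilt from `Q′` and the transposed piece `skew E`.
Joint-unique : ∀ {X Y e es R ρ d ds C γ R′ ρ′ d′ ds′ γ′} →
  Joint X Y e es R ρ d ds C γ → Joint X Y e es R′ ρ′ d′ ds′ C γ′ → d ≡ d′ × ds ≡ ds′
Joint-unique J J′ with Run-functional (Joint-Run J) (Joint-Run J′)
... | refl , refl with suc-injective (trans (sym (Joint-box J)) (Joint-box J′))
...   | refl = unique J J′
  where
  unique : ∀ {X Y e es R ρ d ds C γ d′ ds′} →
    Joint X Y e es R ρ d ds C γ → Joint X Y e es R ρ d′ ds′ C γ → d ≡ d′ × ds ≡ ds′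
  unique start start = refl , refl
  unique (asc J _ _ _ j _ _) (asc J′ _ _ _ j′ _ _) with Ins-injective j j′
  ... | refl , refl = let p , q = Joint-unique J J′ in refl , cong₂ _∷_ p q
  unique {X} (asc _ a _ _ _ _ _) (small _ b _ _ _ _ _ _ _) = ⊥-elim (asc-desc X a b)
  unique {X} (asc _ a _ _ _ _ _) (cut _ _ _ b _ _ _ _ _ _ _ _ _ _ _ _ _) = ⊥-elim (asc-desc X a b)
  unique {X} (small _ b _ _ _ _ _ _ _) (asc _ a _ _ _ _ _) = ⊥-elim (asc-desc X a b)
  unique {X} (cut _ _ _ b _ _ _ _ _ _ _ _ _ _ _ _ _) (asc _ a _ _ _ _ _) = ⊥-elim (asc-desc X a b)
  unique (small J _ _ _ _ _ j _ _) (small J′ _ _ _ _ _ j′ _ _) with Ins-injective j j′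
  ... | refl , refl = let p , q = Joint-unique J J′ in refl , cong₂ _∷_ p q
  unique {X} (small J _ _ s _ _ _ _ _) (cut E {Q} _ J′ _ _ refl _ c _ _ _ _ _ _ _ _ _)
    with Run-functional (Joint-Run J) (Joint-Run J′)
  ... | refl , _ = contradiction s (<⇒≱ (≤-<-trans (≤-reflexive (sym c)) (cnt-cut E (letter X) Q)))
  unique {X} (cut E {Q} _ J′ _ _ refl _ c _ _ _ _ _ _ _ _ _) (small J _ _ s _ _ _ _ _)
    with Run-functional (Joint-Run J) (Joint-Run J′)
  ... | refl , _ = contradiction s (<⇒≱ (≤-<-trans (≤-reflexive (sym c)) (cnt-cut E (letter X) Q)))
  unique (cut E E′ J _ _ r c rq _ s _ i j _ _ _ _) (cut F F′ J′ _ _ r′ c′ rq′ _ s′ _ i′ j′ _ _ _ _)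
    with Run-functional (Joint-Run J) (Joint-Run J′)
  ... | refl , _ with cut-unique E F (trans (sym r) r′) (trans rq (sym rq′))
  ...   | refl , refl with Ins-injective j j′ | trans s (sym s′)
  ...     | refl , refl | refl with trans c (sym c′)
  ...       | refl = let p , q = Joint-unique J J′ in refl , cong₂ _∷_ p q

-- Transposing a run

private
  cong-≤ : ∀ {a a′ b b′} → a ≡ a′ → b ≡ b′ → a ≤ b → a′ ≤ b′
  cong-≤ refl refl le = le

module _ (X : Side) where
  private
    Y = dual X

  -- The given run is unwound from its end, and `C` is an arbitrary tableau of the transposed final
  -- shape: reverse insertion from the prescribed cells determines the earlier tableaux, and with
  -- them the code on side `Y`.
  transpose : ∀ {e es R ρ C} → Run X e es R ρ → Yam C → Conj R C →
              ∃[ d ] ∃[ ds ] ∃[ γ ] Joint X Y e es R ρ d ds C γ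
  transpose start y κ with Conj-start y κ
  ... | refl = _ , _ , _ , start
  transpose (asc {R = R} {ρ₁ = ρ₁} r a i) y κ
    with Ins-Yam (Run-Yam r) i
  ... | _ , add with Conj-Ins⁻ (Run-Yam r) add y (Conj-resp (Ins-cnt i) (λ _ → refl) κ)
  ...   | C , d′ , j , y₀ , κ₀ , eq with transpose r y₀ κ₀
  ...     | d , ds , γ , J = _ , _ , _ , asc J a a′ i j refl (sym eq)
    where
    a′ : Asc Y d d′
    a′ with Run-last r | Run-last (Joint-Run (Joint-sym J))
    ... | _ , iˡ , _ | _ , jˡ , _ =
      bump-asc⁻ Y jˡ j (box-asc X (Run-Yam r) add (Joint-box J) (bump-asc X iˡ i a))
  transpose (small {R = R} {ρ₁ = ρ₁} r a s i) y κ
    with Ins-Yam (Run-Yam r) i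
  ... | _ , add with Conj-Ins⁻ (Run-Yam r) add y (Conj-resp (Ins-cnt i) (λ _ → refl) κ)
  ...   | C , d′ , j , y₀ , κ₀ , eq with transpose r y₀ κ₀
  ...     | d , ds , γ , J = _ , _ , _ , small J a a′ s s′ i j refl (sym eq)
    where
    a′ : Desc Y d d′
    a′ with Run-last r | Run-last (Joint-Run (Joint-sym J))
    ... | _ , iˡ , _ | _ , jˡ , _ =
      bump-desc⁻ Y jˡ j (box-desc X (Run-Yam r) add (Joint-box J) (bump-desc X iˡ i a))
    s′ : cnt C (letter Y) ≤ height Y
    s′ = cong-≤ (cong (cnt C) (height≡letter-dual X)) (letter≡height-dual X)
           (≮⇒≥ λ lt → <⇒≱ (col⇒row κ₀ lt) s)
  transpose (cut {R = R} {ρ₁ = ρ₁} E {Q} r a refl c i m) y κ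
    with Yam-++⁻ʳ E (Run-Yam r)
  ... | addX ∷ yQ with Ins-Yam yQ i
  ...   | _ , add with Conj-Ins⁻ yQ add y (Conj-resp (Ins-cnt i) (λ _ → refl) κ)
  ...     | Q′ , d′ , j , yQ′ , κQ , eq
    -- What was cut off is put back on the transposed side: the first removed cell in position
    -- `letter Y`, then the cells of `E` with rows and columns exchanged.
    with skew-Conj E {Q′ = letter Y ∷ Q′} (Run-Yam r) ((λ {_} → addY) ∷ yQ′) κ⁺
    where
    col : letter Y ≡ cnt Q (letter X)
    col = sym (trans c (height≡letter-dual X))
    addY : Addable (letter Y) Q′
    addY = subst (λ γ → Addable γ Q′) (sym col) (Conj-Addable κQ addX)
    κ⁺ : Conj (letter X ∷ Q) (letter Y ∷ Q′)
    κ⁺ = Conj-∷ col (sym (trans (cong (cnt Q′) col) (Conj-count κQ addX))) κQ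
  ...       | yC , κC , sk with transpose r yC κC
  ...         | d , ds , γ , J = _ , _ , _ ,
    cut E (skew E (letter X ∷ Q)) J a (cut-desc Y (Joint-Run (Joint-sym J)) refl c′ j m′) refl refl c c′ refl sk i j m m′ refl (sym eq)
    where
    c′ : cnt Q′ (letter Y) ≡ height Y
    c′ = trans (cong (cnt Q′) (trans (sym (height≡letter-dual X)) (sym c))) (trans (Conj-count κQ addX) (letter≡height-dual X))
    -- In one column only one cell can be added to the shape of `Q`, so meeting the removed cell on
    -- side `Y` would mean meeting it on side `X`.
    m′ : cnt Q ρ₁ ≢ letter Y
    m′ eq = m (Addable-unique add addX (trans eq (trans (sym (height≡letter-dual X)) (sym c))))

-- Increasing and decreasing subsequences

opaque
  rank : List ℕ → ℕ → ℕ
  rank [] x = 0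
  rank (y ∷ us) x with y <? x
  ... | yes _ = suc (rank us x)
  ... | no _ = rank us x

  rank-[] : ∀ x → rank [] x ≡ 0
  rank-[] x = refl

  rank-< : ∀ {y x} us → y < x → rank (y ∷ us) x ≡ suc (rank us x)
  rank-< {y} {x} us y<x with y <? x
  ... | yes _ = refl
  ... | no ≮ = contradiction y<x ≮

  rank-≥ : ∀ {y x} us → x ≤ y → rank (y ∷ us) x ≡ rank us x
  rank-≥ {y} {x} us x≤y with y <? x
  ... | yes lt = contradiction lt (≤⇒≯ x≤y)
  ... | no _ = refl

rank-mono : ∀ us {x x′} → x ≤ x′ → rank us x ≤ rank us x′
rank-mono [] {x} le = ≤-trans (≤-reflexive (rank-[] x)) z≤n
rank-mono (y ∷ us) {x} {x′} le with y <? x | y <? x′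
... | yes p | yes q rewrite rank-< us p | rank-< us q = s≤s (rank-mono us le)
... | yes p | no ≮ = contradiction (<-≤-trans p le) ≮
... | no p | yes q rewrite rank-≥ us (≮⇒≥ p) | rank-< us q = m≤n⇒m≤1+n (rank-mono us le)
... | no p | no q rewrite rank-≥ us (≮⇒≥ p) | rank-≥ us (≮⇒≥ q) = rank-mono us le

rank≤length : ∀ us x → rank us x ≤ length us
rank≤length [] x = ≤-reflexive (rank-[] x)
rank≤length (y ∷ us) x with y <? x
... | yes p rewrite rank-< us p = s≤s (rank≤length us x)
... | no p rewrite rank-≥ us (≮⇒≥ p) = m≤n⇒m≤1+n (rank≤length us x)

rank-suc : ∀ {us x} → All (x ≢_) us → rank us (suc x) ≡ rank us x
rank-suc {x = x} [] = trans (rank-[] (suc x)) (sym (rank-[] x))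
rank-suc {y ∷ us} {x} (x≢y ∷ d) with <-cmp y x
... | tri< lt _ _ rewrite rank-< us lt | rank-< us (m≤n⇒m≤1+n lt) = cong suc (rank-suc d)
... | tri≈ _ eq _ = contradiction (sym eq) x≢y
... | tri> _ _ gt rewrite rank-≥ us gt | rank-≥ us (<⇒≤ gt) = rank-suc d

codes : List ℕ → List ℕ
codes [] = []
codes (x ∷ us) = rank us x ∷ codes us

Distinct : List ℕ → Set
Distinct = AllPairs _≢_

-- The tableau of all entries with nothing cut off. Schensted's theorem holds for it, and the
-- tableaux of runs are compared with its lower segments.
data Tab : List ℕ → List ℕ → Set where
  [] : Tab [] []
  add : ∀ {x us w w′ ρ} → Tab us w → Ins w (rank us x) w′ ρ → Tab (x ∷ us) w′

Tab-length : ∀ {us w} → Tab us w → length w ≡ length us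
Tab-length [] = refl
Tab-length (add t i) = trans (Ins-length i) (cong suc (Tab-length t))

Tab-Yam : ∀ {us w} → Tab us w → Yam w
Tab-Yam [] = []
Tab-Yam (add t i) = proj₁ (Ins-Yam (Tab-Yam t) i)

Tab-total : ∀ us → ∃[ w ] Tab us w
Tab-total [] = [] , []
Tab-total (x ∷ us) with Tab-total us
... | w , t with Ins-total w (≤-trans (rank≤length us x) (≤-reflexive (sym (Tab-length t))))
...   | w′ , ρ , i = w′ , add t i

Tab-functional : ∀ {us w w′} → Tab us w → Tab us w′ → w ≡ w′
Tab-functional [] [] = refl
Tab-functional (add t i) (add t′ i′) with Tab-functional t t′
... | refl = proj₁ (Ins-functional i i′)

++-regroup : ∀ (F E G : List ℕ) {B} → F ++ E ++ G ++ B ≡ (F ++ E ++ G) ++ B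
++-regroup F E G {B} = sym (trans (++-assoc F (E ++ G) B) (cong (F ++_) (++-assoc E G B)))

split-bottom : ∀ (w : List ℕ) {g} → g ≤ length w → ∃₂ λ F R → w ≡ F ++ R × length R ≡ g
split-bottom [] z≤n = [] , [] , refl , refl
split-bottom (c ∷ w) {g} le with g ≟ suc (length w)
... | yes refl = [] , c ∷ w , refl , refl
... | no g≢ with split-bottom w (≤-pred (≤∧≢⇒< le g≢))
...   | F , R , refl , eq = c ∷ F , R , refl , eq

-- The predicate `S` accumulates a bound by every chosen later entry, so the relation holds between
-- all pairs of the chain and not only between neighbours.
Has : (ℕ → ℕ → Set) → List ℕ → ℕ → (ℕ → Set) → Set
Has _≺_ us zero S = ⊤
Has _≺_ [] (suc r) S = ⊥
Has _≺_ (x ∷ us) (suc r) S = Has _≺_ us (suc r) S ⊎ (S x × Has _≺_ us r λ y → S y × y ≺ x)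

Has-map : ∀ {_≺_} us r {S S′ : ℕ → Set} → (∀ {y} → S y → S′ y) → Has _≺_ us r S → Has _≺_ us r S′
Has-map us zero f h = tt
Has-map (x ∷ us) (suc r) f (inj₁ h) = inj₁ (Has-map us (suc r) f h)
Has-map (x ∷ us) (suc r) f (inj₂ (s , h)) = inj₂ (f s , Has-map us r (λ (s , p) → f s , p) h)

-- A carry that is still in row 0 at the end has met no entry of that row above the new one.
Ins-zero : ∀ {w g w′} → Ins w g w′ 0 → ∀ G {B} → w ≡ G ++ B → length B ≡ g → cnt w 0 ≡ cnt B 0
Ins-zero here [] refl _ = refl
Ins-zero here (_ ∷ G) {B} refl eq = contradiction (length-++-≤ G B) (<⇒≱ (≤-reflexive (sym eq)))
Ins-zero (skip _ i) [] refl refl = contradiction (Ins-gap≤ i) 1+n≰n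
Ins-zero (skip {c} {w} c≢ i) (_ ∷ G) refl eq = trans (cnt-miss w c≢) (Ins-zero i G refl eq)

Ins-nonzero : ∀ {w g w′ ρ} → Ins w g w′ ρ → ρ ≢ 0 → ∀ G {B} → w ≡ G ++ B → length B ≡ g → cnt B 0 < cnt w 0
Ins-nonzero here ρ≢0 _ _ _ = contradiction refl ρ≢0
Ins-nonzero (skip _ i) _ [] refl refl = contradiction (Ins-gap≤ i) 1+n≰n
Ins-nonzero (bump i) _ [] refl refl = contradiction (Ins-gap≤ i) 1+n≰n
Ins-nonzero (skip {c} {w} _ i) ρ≢0 (_ ∷ G) refl eq = <-≤-trans (Ins-nonzero i ρ≢0 G refl eq) (cnt-≤-∷ c w 0)
Ins-nonzero (bump {w} {ρ = zero} i) _ (_ ∷ G) {B} refl eq = ≤-<-trans (cnt-++-≤ G B 0) (cnt-cut [] 0 w)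
Ins-nonzero (bump {w} {ρ = suc ρ} i) _ (_ ∷ G) refl eq = <-≤-trans (Ins-nonzero i (λ ()) G refl eq) (cnt-≤-∷ (suc ρ) w 0)

data Restrict (x b : ℕ) (us w R′ : List ℕ) : Set where
  outside : ∀ F → b ≤ x → w ≡ F ++ R′ → length R′ ≡ rank us b → Restrict x b us w R′
  inside : ∀ F R ρ → x < b → w ≡ F ++ R → Ins R (rank us x) R′ ρ → length R ≡ rank us b → Restrict x b us w R′

restrict : ∀ {x us w w′ ρ} b → Ins w (rank us x) w′ ρ → ∀ F′ {R′} → w′ ≡ F′ ++ R′ →
           length R′ ≡ rank (x ∷ us) b → Restrict x b us w R′
restrict {x} {us} b i F′ eq len with x <? b
... | yes lt with trans len (rank-< us lt)
...   | len′ with Ins-above i F′ eq (<-≤-trans (s≤s (rank-mono us (<⇒≤ lt))) (≤-reflexive (sym len′)))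
...     | F , R , ρ₀ , eq₀ , j = inside F R ρ₀ lt eq₀ j (suc-injective (trans (sym (Ins-length j)) len′))
restrict {x} {us} b i F′ eq len | no ≮ with trans len (rank-≥ us (≮⇒≥ ≮))
... | len′ with Ins-below i F′ eq (≤-trans (≤-reflexive len′) (rank-mono us (≮⇒≥ ≮)))
...   | F , eq₀ = outside F (≮⇒≥ ≮) eq₀ len′

-- Schensted's theorem for the entries below `b`, which fill the lower segment `R`. If `B` is the
-- part below a new entry `x`, then `suc (cnt B 0)` is the length of the longest chain ending in
-- `x`. It becomes the length of the first row when the carry stays in row 0; otherwise an entry was
-- bumped from there and the row was at least that long.
lis : ∀ {us w} → Tab us w → ∀ F {R} b → w ≡ F ++ R → length R ≡ rank us b → ∀ r →
      (r ≤ cnt R 0 → Has _<_ us r (_< b)) × (Has _<_ us r (_< b) → r ≤ cnt R 0)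
lis _ F b eq len zero = (λ _ → tt) , λ _ → z≤n
lis [] [] b refl len (suc r) = (λ le → contradiction (≤-trans le (≤-reflexive (cnt-[] 0))) λ ()) , λ ()
lis (add {x} {us} t i) F′ b eq len (suc r) with restrict b i F′ eq len
... | outside F le eq₀ len₀ with lis t F b eq₀ len₀ (suc r)
...   | to , from = (λ p → inj₁ (to p)) , λ { (inj₁ h) → from h ; (inj₂ (lt , _)) → contradiction lt (≤⇒≯ le) }
lis (add {x} {us} t i) F′ {R′} b eq len (suc r) | inside F R ρ lt refl j len₀ with split-bottom R (Ins-gap≤ j)
... | G , B , refl , lenB with lis t F b refl len₀ (suc r) | lis t (F ++ G) x (sym (++-assoc F G B)) lenB r | ρ ≟ 0
...   | to , from | to′ , from′ | yes refl =
        (λ p → inj₂ (lt , Has-map us r (λ q → <-trans q lt , q) (to′ (≤-pred (≤-trans p (≤-reflexive eqR′)))))) ,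
        λ { (inj₁ h) → ≤-trans (from h) (Ins-cnt-≤ j 0)
          ; (inj₂ (_ , h)) → ≤-trans (s≤s (from′ (Has-map us r proj₂ h))) (≤-reflexive (sym eqR′)) }
  where
  eqR′ : cnt R′ 0 ≡ suc (cnt B 0)
  eqR′ = trans (Ins-cnt j 0) (trans (cnt-hit 0 (G ++ B)) (cong suc (Ins-zero j G refl lenB)))
...   | to , from | to′ , from′ | no ρ≢0 =
        (λ p → inj₁ (to (≤-trans p (≤-reflexive (trans (Ins-cnt j 0) (cnt-miss (G ++ B) ρ≢0)))))) ,
        λ { (inj₁ h) → ≤-trans (from h) (Ins-cnt-≤ j 0)
          ; (inj₂ (_ , h)) → ≤-trans (s≤s (from′ (Has-map us r proj₂ h))) (≤-trans (Ins-nonzero j ρ≢0 G refl lenB) (Ins-cnt-≤ j 0)) }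

-- Increasing subwords of lattice words and longest decreasing subsequences

opaque
  step : ℕ → (ℕ → ℕ) → ℕ → ℕ
  step c f t with c <? t
  ... | yes _ = f t ⊔ suc (f c)
  ... | no _ = f t

  step-< : ∀ {c t} f → c < t → step c f t ≡ f t ⊔ suc (f c)
  step-< {c} {t} f lt with c <? t
  ... | yes _ = refl
  ... | no ≮ = contradiction lt ≮

  step-≥ : ∀ {c t} f → t ≤ c → step c f t ≡ f t
  step-≥ {c} {t} f le with c <? t
  ... | yes lt = contradiction lt (≤⇒≯ le)
  ... | no _ = refl

step-≤ˡ : ∀ c f t → f t ≤ step c f t
step-≤ˡ c f t with c <? t
... | yes lt rewrite step-< f lt = m≤m⊔n _ _
... | no ≮ rewrite step-≥ f (≮⇒≥ ≮) = ≤-refl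

step-≤ʳ : ∀ {c t} f → c < t → suc (f c) ≤ step c f t
step-≤ʳ {c} {t} f lt rewrite step-< f lt = m≤n⊔m (f t) _

step-lub : ∀ c f t {z} → f t ≤ z → (c < t → suc (f c) ≤ z) → step c f t ≤ z
step-lub c f t p q with c <? t
... | yes lt rewrite step-< f lt = ⊔-lub p (q lt)
... | no ≮ rewrite step-≥ f (≮⇒≥ ≮) = p

step-sel : ∀ c f t → step c f t ≡ f t ⊎ (c < t × step c f t ≡ suc (f c))
step-sel c f t with c <? t
... | no ≮ = inj₁ (step-≥ f (≮⇒≥ ≮))
... | yes lt rewrite step-< f lt = Sum.map₂ (lt ,_) (⊔-sel (f t) (suc (f c)))

-- `step c f t` is the length of the longest strictly increasing subword with letters
-- below t once c is put on top of a word with lengths f.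
record Profile (f : ℕ → ℕ) : Set where
  field
    base : f 0 ≡ 0
    mono : ∀ {t t′} → t ≤ t′ → f t ≤ f t′
    lip  : ∀ t → f (suc t) ≤ suc (f t)
open Profile

Profile-0 : Profile (λ _ → 0)
Profile-0 = record { base = refl ; mono = λ _ → z≤n ; lip = λ _ → z≤n }

Profile-step : ∀ c {f} → Profile f → Profile (step c f)
Profile-step c {f} p .base = trans (step-≥ f z≤n) (base p)
Profile-step c {f} p .mono {t} {t′} le = step-lub c f t (≤-trans (mono p le) (step-≤ˡ c f t′))
  λ lt → step-≤ʳ f (<-≤-trans lt le)
Profile-step c {f} p .lip t = step-lub c f (suc t) (≤-trans (lip p t) (s≤s (step-≤ˡ c f t)))
  λ lt → s≤s (≤-trans (mono p (≤-pred lt)) (step-≤ˡ c f t))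

lip* : ∀ {f t} → Profile f → ∀ s → f (s + t) ≤ s + f t
lip* p zero = ≤-refl
lip* {t = t} p (suc s) = ≤-trans (lip p (s + t)) (s≤s (lip* p s))

-- How these lengths change, from f before to h after, along an insertion with
-- carry ρ: they agree above ρ, and f t = h t ⊔ (h (suc ρ) ∸ (ρ ∸ t)) for t ≤ ρ.
record Shift (ρ : ℕ) (f h : ℕ → ℕ) : Set where
  field
    hi  : ∀ {t} → ρ < t → f t ≡ h t
    lo₁ : ∀ {t} → t ≤ ρ → h t ≤ f t
    lo₂ : ∀ s {t} → s + t ≡ ρ → h (suc ρ) ≤ s + f t
    lo₃ : ∀ s {t} → s + t ≡ ρ → f t ≤ h t ⊎ s + f t ≤ h (suc ρ)
open Shift

Shift-0 : ∀ ρ → Shift ρ (λ _ → 0) (λ _ → 0)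
Shift-0 ρ = record { hi = λ _ → refl ; lo₁ = λ _ → z≤n ; lo₂ = λ _ _ → z≤n ; lo₃ = λ _ _ → inj₁ z≤n }

private
  gap : ∀ {c ρ} → c < ρ → ∃[ s ] suc s + c ≡ ρ
  gap {c} {ρ} lt = ρ ∸ suc c , trans (sym (+-suc (ρ ∸ suc c) c)) (m∸n+n≡m lt)

-- The surplus of `f` below `ρ` does no harm above it: for `c < ρ` a surplus value `f c` is at most
-- `h (suc ρ) ∸ (ρ ∸ c)`, so that a chain prolonged by `c` still has length at most `h (suc ρ)`.
-- This needs `c ≢ ρ`.
Shift-skip : ∀ {ρ f h c} → Profile h → c ≢ ρ → Shift ρ f h → Shift ρ (step c f) (step c h)
Shift-skip {ρ} {f} {h} {c} ph c≢ρ σ = record { hi = hi′ ; lo₁ = lo₁′ ; lo₂ = lo₂′ ; lo₃ = lo₃′ }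
  where
  f≤h : ∀ {t} → ρ < t → c < t → suc (f c) ≤ step c h t
  f≤h {t} ρ<t lt with <-cmp c ρ
  ... | tri≈ _ eq _ = contradiction eq c≢ρ
  ... | tri> _ _ gt = ≤-trans (s≤s (≤-reflexive (hi σ gt))) (step-≤ʳ h lt)
  ... | tri< c<ρ _ _ with gap c<ρ
  ...   | s , eq with lo₃ σ (suc s) eq
  ...     | inj₁ le = ≤-trans (s≤s le) (step-≤ʳ h lt)
  ...     | inj₂ le = ≤-trans (≤-trans (s≤s (m≤n+m (f c) s)) le) (≤-trans (mono ph ρ<t) (step-≤ˡ c h t))
  h≤f : h c ≤ f c
  h≤f with <-cmp c ρ
  ... | tri≈ _ eq _ = contradiction eq c≢ρ
  ... | tri> _ _ gt = ≤-reflexive (sym (hi σ gt))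
  ... | tri< lt _ _ = lo₁ σ (<⇒≤ lt)
  hi′ : ∀ {t} → ρ < t → step c f t ≡ step c h t
  hi′ {t} ρ<t = ≤-antisym
    (step-lub c f t (≤-trans (≤-reflexive (hi σ ρ<t)) (step-≤ˡ c h t)) (f≤h ρ<t))
    (step-lub c h t (≤-trans (≤-reflexive (sym (hi σ ρ<t))) (step-≤ˡ c f t)) λ lt → ≤-trans (s≤s h≤f) (step-≤ʳ f lt))
  lo₁′ : ∀ {t} → t ≤ ρ → step c h t ≤ step c f t
  lo₁′ {t} le = step-lub c h t (≤-trans (lo₁ σ le) (step-≤ˡ c f t)) λ lt → ≤-trans (s≤s h≤f) (step-≤ʳ f lt)
  lo₂′ : ∀ s {t} → s + t ≡ ρ → step c h (suc ρ) ≤ s + step c f t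
  lo₂′ s {t} eq = step-lub c h (suc ρ) (≤-trans (lo₂ σ s eq) (+-monoʳ-≤ s (step-≤ˡ c f t))) below
    where
    below : c < suc ρ → suc (h c) ≤ s + step c f t
    below c≤ρ with c <? t
    ... | yes lt = ≤-trans (≤-trans (s≤s h≤f) (step-≤ʳ f lt)) (m≤n+m _ s)
    ... | no ≮ = begin
      suc (h c)             ≡⟨ cong (λ z → suc (h z)) (sym (m∸n+n≡m (≮⇒≥ ≮))) ⟩
      suc (h (c ∸ t + t))   ≤⟨ s≤s (lip* ph (c ∸ t)) ⟩
      suc (c ∸ t) + h t     ≤⟨ +-monoˡ-≤ (h t) (+-cancelʳ-≤ t _ _ (≤-trans (s≤s (≤-reflexive (m∸n+n≡m (≮⇒≥ ≮)))) (≤-trans (≤∧≢⇒< (≤-pred c≤ρ) c≢ρ) (≤-reflexive (sym eq))))) ⟩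
      s + h t               ≤⟨ +-monoʳ-≤ s (≤-trans (lo₁ σ (≤-trans (m≤n+m t s) (≤-reflexive eq))) (step-≤ˡ c f t)) ⟩
      s + step c f t        ∎ where open ≤-Reasoning
  lo₃′ : ∀ s {t} → s + t ≡ ρ → step c f t ≤ step c h t ⊎ s + step c f t ≤ step c h (suc ρ)
  lo₃′ s {t} eq with step-sel c f t
  ... | inj₁ e rewrite e = Sum.map (λ p → ≤-trans p (step-≤ˡ c h t)) (λ p → ≤-trans p (step-≤ˡ c h (suc ρ))) (lo₃ σ s eq)
  ... | inj₂ (lt , e) rewrite e with gap lt
  ...   | s′ , eq′ with lo₃ σ (s + suc s′) (trans (+-assoc s (suc s′) c) (trans (cong (s +_) eq′) eq))
  ...     | inj₁ p = inj₁ (≤-trans (s≤s p) (step-≤ʳ h lt))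
  ...     | inj₂ p = inj₂ (begin
    s + suc (f c)          ≤⟨ +-monoʳ-≤ s (s≤s (m≤n+m (f c) s′)) ⟩
    s + (suc s′ + f c)     ≡⟨ sym (+-assoc s (suc s′) (f c)) ⟩
    s + suc s′ + f c       ≤⟨ p ⟩
    h (suc ρ)              ≤⟨ step-≤ˡ c h (suc ρ) ⟩
    step c h (suc ρ)       ∎) where open ≤-Reasoning

-- Since `f ρ` equals `h (suc ρ)`, the letter `ρ` before and the letter `suc ρ` after the bump
-- prolong chains of the same length. The Lipschitz bound makes these prolonged chains the longest
-- ones just above the letter.
Shift-bump : ∀ {ρ f h} → Profile h → Shift ρ f h → Shift (suc ρ) (step ρ f) (step (suc ρ) h)
Shift-bump {ρ} {f} {h} ph σ = record { hi = hi′ ; lo₁ = lo₁′ ; lo₂ = lo₂′ ; lo₃ = lo₃′ }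
  where
  top : f ρ ≡ h (suc ρ)
  top = ≤-antisym ([ (λ p → ≤-trans p (mono ph (n≤1+n ρ))) , (λ p → p) ]′ (lo₃ σ 0 refl)) (lo₂ σ 0 refl)
  ceil : step (suc ρ) h (suc (suc ρ)) ≡ suc (h (suc ρ))
  ceil = trans (step-< h ≤-refl) (m≤n⇒m⊔n≡n (lip ph (suc ρ)))
  next : step ρ f (suc ρ) ≡ suc (h (suc ρ))
  next = trans (step-< f ≤-refl) (trans (cong₂ (λ a b → a ⊔ suc b) (hi σ ≤-refl) top) (m≤n⇒m⊔n≡n (n≤1+n _)))
  hi′ : ∀ {t} → suc ρ < t → step ρ f t ≡ step (suc ρ) h t
  hi′ lt = trans (step-< f (<-trans ≤-refl lt)) (trans (cong₂ (λ a b → a ⊔ suc b) (hi σ (<-trans ≤-refl lt)) top) (sym (step-< h lt)))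
  lo₁′ : ∀ {t} → t ≤ suc ρ → step (suc ρ) h t ≤ step ρ f t
  lo₁′ {t} le with t ≟ suc ρ
  ... | yes refl rewrite step-≥ h le | next = n≤1+n _
  ... | no t≢ = ≤-trans (≤-reflexive (step-≥ h le)) (≤-trans (lo₁ σ (≤-pred (≤∧≢⇒< le t≢))) (step-≤ˡ ρ f t))
  lo₂′ : ∀ s {t} → s + t ≡ suc ρ → step (suc ρ) h (suc (suc ρ)) ≤ s + step ρ f t
  lo₂′ zero refl rewrite ceil | next = ≤-refl
  lo₂′ (suc s) {t} eq rewrite ceil = s≤s (≤-trans (lo₂ σ s (suc-injective eq)) (+-monoʳ-≤ s (step-≤ˡ ρ f t)))
  lo₃′ : ∀ s {t} → s + t ≡ suc ρ → step ρ f t ≤ step (suc ρ) h t ⊎ s + step ρ f t ≤ step (suc ρ) h (suc (suc ρ))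
  lo₃′ zero refl rewrite ceil | next = inj₂ ≤-refl
  lo₃′ (suc s) {t} eq rewrite ceil
    | step-≥ {ρ} {t} f (≤-trans (m≤n+m t s) (≤-reflexive (suc-injective eq)))
    | step-≥ {suc ρ} {t} h (≤-trans (m≤n+m t (suc s)) (≤-reflexive eq)) = Sum.map₂ s≤s (lo₃ σ s (suc-injective eq))

Shift-resp : ∀ {ρ f f′ h} → (∀ t → f t ≡ f′ t) → Shift ρ f h → Shift ρ f′ h
Shift-resp eq σ .hi lt = trans (sym (eq _)) (hi σ lt)
Shift-resp eq σ .lo₁ le = ≤-trans (lo₁ σ le) (≤-reflexive (eq _))
Shift-resp eq σ .lo₂ s e = ≤-trans (lo₂ σ s e) (≤-reflexive (cong (s +_) (eq _)))
Shift-resp eq σ .lo₃ s {t} e = Sum.map (≤-trans (≤-reflexive (sym (eq t)))) (≤-trans (≤-reflexive (cong (s +_) (sym (eq t))))) (lo₃ σ s e)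

Shift-new : ∀ {f} → Profile f → Shift 0 (λ t → f t ⊔ 1) (step 0 f)
Shift-new {f} p = record { hi = hi′ ; lo₁ = lo₁′ ; lo₂ = lo₂′ ; lo₃ = lo₃′ }
  where
  one : step 0 f 1 ≡ 1
  one = trans (step-< f ≤-refl) (trans (cong (λ z → f 1 ⊔ suc z) (base p)) (m≤n⇒m⊔n≡n (≤-trans (lip p 0) (s≤s (≤-reflexive (base p))))))
  hi′ : ∀ {t} → 0 < t → f t ⊔ 1 ≡ step 0 f t
  hi′ {t} lt = sym (trans (step-< f lt) (cong (λ z → f t ⊔ suc z) (base p)))
  lo₁′ : ∀ {t} → t ≤ 0 → step 0 f t ≤ f t ⊔ 1
  lo₁′ {t} le rewrite step-≥ {0} {t} f le = m≤m⊔n (f t) 1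
  lo₂′ : ∀ s {t} → s + t ≡ 0 → step 0 f 1 ≤ s + (f t ⊔ 1)
  lo₂′ s {t} e rewrite one = ≤-trans (m≤n⊔m (f t) 1) (m≤n+m _ s)
  lo₃′ : ∀ s {t} → s + t ≡ 0 → f t ⊔ 1 ≤ step 0 f t ⊎ s + (f t ⊔ 1) ≤ step 0 f 1
  lo₃′ zero refl rewrite one = inj₂ (≤-reflexive (cong (_⊔ 1) (base p)))

-- Only the top `n` letters count, so this measures the skew piece of the `n` largest entries: the
-- longest decreasing subsequence of its row reading word.
rise : ℕ → List ℕ → ℕ → ℕ
rise zero w = λ _ → 0
rise (suc n) [] = λ _ → 0
rise (suc n) (c ∷ w) = step c (rise n w)

Profile-rise : ∀ n w → Profile (rise n w)
Profile-rise zero w = Profile-0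
Profile-rise (suc n) [] = Profile-0
Profile-rise (suc n) (c ∷ w) = Profile-step c (Profile-rise n w)

rise-above : ∀ {w g w′ ρ} → Ins w g w′ ρ → ∀ n → n + g ≤ length w → Shift ρ (rise n w) (rise n w′)
rise-above i zero _ = Shift-0 _
rise-above here (suc n) le = contradiction (m≤n+m _ n) (<⇒≱ le)
rise-above (skip {w′ = w′} c≢ i) (suc n) le = Shift-skip (Profile-rise n w′) c≢ (rise-above i n (≤-pred le))
rise-above (bump {w′ = w′} i) (suc n) le = Shift-bump (Profile-rise n w′) (rise-above i n (≤-pred le))

step-⊔ : ∀ c f h t → step c (λ t → f t ⊔ suc (h t)) t ≡ step c f t ⊔ suc (step c h t)
step-⊔ c f h t with c <? t
... | yes lt rewrite step-< (λ t → f t ⊔ suc (h t)) lt | step-< f lt | step-< h lt =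
      interchange ⊔-commutativeSemigroup (f t) (suc (h t)) (suc (f c)) (suc (suc (h c)))
... | no ≮ rewrite step-≥ (λ t → f t ⊔ suc (h t)) (≮⇒≥ ≮) | step-≥ f (≮⇒≥ ≮) | step-≥ h (≮⇒≥ ≮) = refl

-- The left profile is what the new entry should produce: old chains among the `n + m` entries
-- around it, or chains among the `n` larger ones prolonged by the new entry. Taking this maximum
-- commutes with `step`, so the carry transforms it like a single profile.
rise-around : ∀ {w g w′ ρ} → Ins w g w′ ρ → ∀ n m → n + g ≡ length w →
              Shift ρ (λ t → rise (n + m) w t ⊔ suc (rise n w t)) (rise (suc (n + m)) w′)
rise-around {w} here zero m _ = Shift-new (Profile-rise m w)
rise-around here (suc n) m eq = contradiction (m≤n+m _ n) (<⇒≱ (≤-reflexive eq))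
rise-around (skip _ i) zero m refl = contradiction (Ins-gap≤ i) 1+n≰n
rise-around (bump i) zero m refl = contradiction (Ins-gap≤ i) 1+n≰n
rise-around (skip {c} {w} {w′ = w′} c≢ i) (suc n) m eq =
  Shift-resp (step-⊔ c _ (rise n w)) (Shift-skip (Profile-rise (suc (n + m)) w′) c≢ (rise-around i n m (suc-injective eq)))
rise-around (bump {w} {w′ = w′} {ρ} i) (suc n) m eq =
  Shift-resp (step-⊔ ρ _ (rise n w)) (Shift-bump (Profile-rise (suc (n + m)) w′) (rise-around i n m (suc-injective eq)))


Ins-row≤ : ∀ {w g w′ ρ} → Ins w g w′ ρ → ρ ≤ length w
Ins-row≤ here = z≤n
Ins-row≤ (skip _ i) = m≤n⇒m≤1+n (Ins-row≤ i)
Ins-row≤ (bump i) = s≤s (Ins-row≤ i)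

rise-[] : ∀ n t → rise n [] t ≡ 0
rise-[] zero t = refl
rise-[] (suc n) t = refl

-- Schensted's theorem for decreasing chains with values in [a, b). The lower end `a` has to vary
-- because the part of a chain before its last entry `x` lies in (x, b); this is why skew pieces are
-- measured. As `t` exceeds every letter and every carry, only the equality `hi` of `Shift` is used.
lds : ∀ {us w} → Tab us w → Distinct us → ∀ F {R} a b n t → w ≡ F ++ R → length R ≡ rank us b →
      n + rank us a ≡ rank us b → length us < t → ∀ r →
      (r ≤ rise n R t → Has _>_ us r (λ y → a ≤ y × y < b)) ×
      (Has _>_ us r (λ y → a ≤ y × y < b) → r ≤ rise n R t)
lds _ _ F a b n t eq len wid lt zero = (λ _ → tt) , λ _ → z≤n
lds [] _ [] a b n t refl len wid lt (suc r) =
  (λ le → contradiction (≤-trans le (≤-reflexive (rise-[] n t))) λ ()) , λ ()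
lds (add {x} {us} τ i) (dx ∷ d) F′ {R′} a b n t eq len wid lt (suc r) with restrict b i F′ eq len
... | outside F b≤x eq₀ len₀ with lds τ d F a b n t eq₀ len₀ wid₀ (<-trans ≤-refl lt) (suc r)
  where
  wid₀ : n + rank us a ≡ rank us b
  wid₀ with x <? a
  ... | no ≮ = trans (cong (n +_) (sym (rank-≥ us (≮⇒≥ ≮)))) (trans wid (rank-≥ us b≤x))
  ... | yes x<a = contradiction
    (≤-trans (m≤n+m _ n) (≤-reflexive (trans (cong (n +_) (sym (rank-< us x<a))) (trans wid (rank-≥ us b≤x)))))
    (<⇒≱ (s≤s (rank-mono us (≤-trans b≤x (<⇒≤ x<a)))))
...   | to , from = (λ p → inj₁ (to p)) , λ { (inj₁ h) → from h ; (inj₂ ((_ , x<b) , _)) → contradiction x<b (≤⇒≯ b≤x) }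
lds (add {x} {us} τ i) (dx ∷ d) F′ {R′} a b n t eq len wid lt (suc r) | inside F R ρ x<b eq₀ j len₀ with x <? a
... | yes x<a = (λ p → inj₁ (proj₁ ih (≤-trans p (≤-reflexive (sym same))))) ,
                λ { (inj₁ h) → ≤-trans (proj₂ ih h) (≤-reflexive same) ; (inj₂ ((a≤x , _) , _)) → contradiction x<a (≤⇒≯ a≤x) }
  where
  wid₀ : n + rank us a ≡ rank us b
  wid₀ = suc-injective (trans (sym (+-suc n _)) (trans (cong (n +_) (sym (rank-< us x<a))) (trans wid (rank-< us x<b))))
  ih = lds τ d F a b n t eq₀ len₀ wid₀ (<-trans ≤-refl lt) (suc r)
  ρ<t : ρ < t
  ρ<t = ≤-<-trans (Ins-row≤ j) (≤-<-trans (≤-trans (≤-reflexive len₀) (rank≤length us b)) (<-trans ≤-refl lt))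
  same : rise n R t ≡ rise n R′ t
  same = hi (rise-above j n (≤-trans (+-monoʳ-≤ n (rank-mono us (<⇒≤ x<a))) (≤-reflexive (trans wid₀ (sym len₀))))) ρ<t
... | no ≮ = to , from
  where
  a≤x = ≮⇒≥ ≮
  m = rank us x ∸ rank us a
  n₁ = rank us b ∸ rank us x
  e₁ : m + rank us a ≡ rank us x
  e₁ = m∸n+n≡m (rank-mono us a≤x)
  e₂ : n₁ + rank us x ≡ rank us b
  e₂ = m∸n+n≡m (rank-mono us (<⇒≤ x<b))
  e₃ : n₁ + m + rank us a ≡ rank us b
  e₃ = trans (+-assoc n₁ m _) (trans (cong (n₁ +_) e₁) e₂)
  n≡ : n ≡ suc (n₁ + m)
  n≡ = +-cancelʳ-≡ (rank us a) n (suc (n₁ + m))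
         (trans (cong (n +_) (sym (rank-≥ us a≤x))) (trans wid (trans (rank-< us x<b) (cong suc (sym e₃)))))
  ρ<t : ρ < t
  ρ<t = ≤-<-trans (Ins-row≤ j) (≤-<-trans (≤-trans (≤-reflexive len₀) (rank≤length us b)) (<-trans ≤-refl lt))
  both : rise (n₁ + m) R t ⊔ suc (rise n₁ R t) ≡ rise n R′ t
  both = trans (hi (rise-around j n₁ m (trans e₂ (sym len₀))) ρ<t) (cong (λ k → rise k R′ t) (sym n≡))
  ih = lds τ d F a b (n₁ + m) t eq₀ len₀ e₃ (<-trans ≤-refl lt) (suc r)
  -- Chains ending in `x` continue in [x + 1, b). As `x` does not occur in `us`, this interval still
  -- contains `n₁` entries.
  ih′ = lds τ d F (suc x) b n₁ t eq₀ len₀ (trans (cong (n₁ +_) (rank-suc dx)) e₂) (<-trans ≤-refl lt) r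
  to : suc r ≤ rise n R′ t → Has _>_ (x ∷ us) (suc r) (λ y → a ≤ y × y < b)
  to p with ⊔-sel (rise (n₁ + m) R t) (suc (rise n₁ R t))
  ... | inj₁ e = inj₁ (proj₁ ih (≤-trans p (≤-reflexive (trans (sym both) e))))
  ... | inj₂ e = inj₂ ((a≤x , x<b) , Has-map us r (λ (p , q) → (≤-trans a≤x (<⇒≤ p) , q) , p)
                   (proj₁ ih′ (≤-pred (≤-trans p (≤-reflexive (trans (sym both) e))))))
  from : Has _>_ (x ∷ us) (suc r) (λ y → a ≤ y × y < b) → suc r ≤ rise n R′ t
  from (inj₁ h) = ≤-trans (proj₂ ih h) (≤-trans (m≤m⊔n _ _) (≤-reflexive both))
  from (inj₂ (_ , h)) = ≤-trans (s≤s (proj₂ ih′ (Has-map us r (λ ((_ , q) , p) → p , q) h)))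
                          (≤-trans (m≤n⊔m _ _) (≤-reflexive both))

-- Chains of length k - 1 and the first cell of column k - 1

Yam-absent : ∀ {w K} → Yam w → cnt w K ≡ 0 → All (_< K) w
Yam-absent [] _ = []
Yam-absent {c ∷ w} {K} (a ∷ y) eq with <-cmp c K
... | tri< lt _ _ = lt ∷ Yam-absent y (trans (sym (cnt-miss w (<⇒≢ lt))) eq)
... | tri≈ _ refl _ = contradiction (trans (sym (cnt-hit c w)) eq) λ ()
... | tri> _ _ gt = contradiction (subst (cnt w c <_) (trans (sym (cnt-miss w (>⇒≢ gt))) eq) (a gt)) n≮0

rise-≤ : ∀ {K w} → All (_< K) w → ∀ n t → rise n w t ≤ rise n w K
rise-≤ _ zero t = z≤n
rise-≤ [] (suc n) t = z≤n
rise-≤ {K} {c ∷ w} (lt ∷ ls) (suc n) t =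
  step-lub c (rise n w) t (≤-trans (rise-≤ ls n t) (step-≤ˡ c (rise n w) K)) λ _ → step-≤ʳ (rise n w) lt

Profile-≤ : ∀ {f} → Profile f → ∀ t → f t ≤ t
Profile-≤ p zero = ≤-reflexive (base p)
Profile-≤ p (suc t) = ≤-trans (lip p t) (s≤s (Profile-≤ p t))

-- In a lattice word a letter `suc p` has a letter `p` beneath it, so the letters 0, ..., `c` form
-- an increasing subword.
rise-present : ∀ {w c t} → Yam w → 0 < cnt w c → c < t → suc c ≤ rise (length w) w t
rise-present {[]} {c} _ pos _ = contradiction (subst (0 <_) (cnt-[] c) pos) n≮0
rise-present {c′ ∷ w} {c} {t} (a ∷ y) pos lt with c′ ≟ c
... | no c′≢c = ≤-trans (rise-present y (subst (0 <_) (cnt-miss w c′≢c) pos) lt) (step-≤ˡ c′ (rise (length w) w) t)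
... | yes refl = ≤-trans (s≤s (lower c a)) (step-≤ʳ (rise (length w) w) lt)
  where
  lower : ∀ c → Addable c w → c ≤ rise (length w) w c
  lower zero _ = z≤n
  lower (suc p) a = rise-present y (≤-<-trans z≤n (a ≤-refl)) ≤-refl

-- A chain of k - 1 entries below `b`. On side `cols` the word belongs to the complemented
-- permutation, so in the original these entries rise and lie above `b`, as in F_k.
Big : Side → List ℕ → ℕ → Set
Big (rows κ) us b = Has _<_ us (suc (suc κ)) (_< b)
Big (cols κ) us b = Has _>_ us (suc (suc κ)) (_< b)

Big-cnt : ∀ X {us w} → Tab us w → Distinct us → ∀ F {R} b → w ≡ F ++ R → length R ≡ rank us b →
          (Big X us b → height X < cnt R (letter X)) × (height X < cnt R (letter X) → Big X us b)
Big-cnt (rows κ) τ _ F b eq len with lis τ F b eq len (suc (suc κ))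
... | to , from = from , to
Big-cnt (cols κ) {us} τ d F {R} b eq len = to , from
  where
  -- Large enough for both uses: `lds` asks for more than `length us`, and `rise-present` for more
  -- than `suc κ`.
  t = suc (suc (κ + length us))
  N = rank us b ∸ rank us 0
  yR : Yam R
  yR = Yam-++⁻ʳ F (subst Yam eq (Tab-Yam τ))
  ih = lds τ d F 0 b N t eq len (m∸n+n≡m (rank-mono us z≤n)) (s≤s (m≤n+m _ (suc κ))) (suc (suc κ))
  zero-rank : ∀ us → rank us 0 ≡ 0
  zero-rank [] = rank-[] 0
  zero-rank (_ ∷ us) = trans (rank-≥ us z≤n) (zero-rank us)
  width : length R ≡ N
  width = trans len (sym (cong (rank us b ∸_) (zero-rank us)))
  to : Has _>_ us (suc (suc κ)) (_< b) → 0 < cnt R (suc κ)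
  to h with cnt R (suc κ) in e
  ... | suc _ = z<s
  ... | zero = contradiction (proj₂ ih (Has-map us (suc (suc κ)) (z≤n ,_) h))
                 (<⇒≱ (s≤s (≤-trans (rise-≤ (Yam-absent yR e) N t) (Profile-≤ (Profile-rise N R) (suc κ)))))
  from : 0 < cnt R (suc κ) → Has _>_ us (suc (suc κ)) (_< b)
  from pos = Has-map us (suc (suc κ)) proj₂ (proj₁ ih
    (subst (λ n → suc (suc κ) ≤ rise n R t) width (rise-present yR pos (s≤s (m≤m+n (suc κ) (length us))))))

-- Avoidance as a condition on runs

-- At some descent there was already a chain of k - 1 entries below b.
data Frozen (X : Side) : List ℕ → ℕ → Set where
  now : ∀ {x z us b} → Desc X (rank us z) (rank (z ∷ us) x) → Big X (z ∷ us) b → Frozen X (x ∷ z ∷ us) b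
  later : ∀ {x us b} → Frozen X us b → Frozen X (x ∷ us) b

-- Frozen entries `F` may be moved by an insertion, but they have no influence on what happens below
-- them.
Ins-extend : ∀ {R g R₁ ρ} → Ins R g R₁ ρ → ∀ F {w′ ρ′} → Ins (F ++ R) g w′ ρ′ → ∃[ F′ ] w′ ≡ F′ ++ R₁
Ins-extend i [] j = [] , proj₁ (Ins-functional j i)
Ins-extend {R} i (c ∷ F) here = contradiction (≤-trans (Ins-gap≤ i) (length-++-≤ F R)) 1+n≰n
Ins-extend i (c ∷ F) (skip _ j) with Ins-extend i F j
... | F′ , refl = c ∷ F′ , refl
Ins-extend i (c ∷ F) (bump j) with Ins-extend i F j
... | F′ , refl = suc c ∷ F′ , refl

Ins-[] : ∀ {g w ρ} → Ins [] g w ρ → w ≡ 0 ∷ []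
Ins-[] here = refl

suffix-≤ : ∀ (F F′ : List ℕ) {C B} → F ++ C ≡ F′ ++ B → length C ≤ length B → ∃[ E ] B ≡ E ++ C
suffix-≤ F [] refl _ = F , refl
suffix-≤ [] (c ∷ F′) {B = B} refl le = contradiction (≤-trans le (length-++-≤ F′ B)) 1+n≰n
suffix-≤ (_ ∷ F) (_ ∷ F′) eq le with ∷-injective eq
... | _ , eq′ = suffix-≤ F F′ eq′ le

find-cut : ∀ R {c h} → h < cnt R c → ∃₂ λ E Q → R ≡ E ++ c ∷ Q × cnt Q c ≡ h
find-cut [] {c} lt = contradiction (subst (_ <_) (cnt-[] c) lt) n≮0
find-cut (d ∷ R) {c} {h} lt with h <? cnt R c
... | yes lt′ with find-cut R lt′
...   | E , Q , refl , eq = d ∷ E , Q , refl , eq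
find-cut (d ∷ R) {c} {h} lt | no ≮ with d ≟ c
... | yes refl = [] , R , refl , ≤-antisym (≮⇒≥ ≮) (≤-pred (subst (h <_) (cnt-hit d R) lt))
... | no d≢c = contradiction (subst (h <_) (cnt-miss R d≢c) lt) ≮

rank-step : ∀ {us x a} b → rank us x ≤ a →
            (rank (x ∷ us) b ≤ suc a → rank us b ≤ a) × (rank us b ≤ a → rank (x ∷ us) b ≤ suc a)
rank-step {us} {x} b le with x <? b
... | yes lt rewrite rank-< us lt = ≤-pred , s≤s
... | no ≮ rewrite rank-≥ us (≮⇒≥ ≮) = (λ _ → ≤-trans (rank-mono us (≮⇒≥ ≮)) le) , m≤n⇒m≤1+n

module _ (X : Side) where
  ¬Big : ∀ {us w} → Tab us w → Distinct us → ∀ F {R} b → w ≡ F ++ R → cnt R (letter X) ≤ height X →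
         rank us b ≤ length R → ¬ Big X us b
  ¬Big τ d F {R} b refl le len big with split-bottom R len
  ... | G , B , refl , lenB = <⇒≱ (proj₁ (Big-cnt X τ d (F ++ G) b (sym (++-assoc F G B)) lenB) big)
                                (≤-trans (cnt-++-≤ G B (letter X)) le)

  cut-Big : ∀ {us w} → Tab us w → Distinct us → ∀ F {Q} b → w ≡ F ++ letter X ∷ Q → cnt Q (letter X) ≡ height X →
            length Q < rank us b → Big X us b
  cut-Big {us} {w} τ d F {Q} b eq cq lt with split-bottom w (≤-trans (rank≤length us b) (≤-reflexive (sym (Tab-length τ))))
  ... | G , B , eq′ , lenB with suffix-≤ F G (trans (sym eq) eq′) (≤-trans lt (≤-reflexive (sym lenB)))
  ...   | E , refl = proj₂ (Big-cnt X τ d G b eq′ lenB)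
                       (≤-<-trans (≤-reflexive (sym cq)) (cnt-cut E (letter X) Q))

  active : ∀ {x us e es R ρ w} → Run X e es R ρ → e ≡ rank us x → es ≡ codes us → Tab (x ∷ us) w → Distinct (x ∷ us) →
           ∃[ F ] (w ≡ F ++ R × (∀ b → (rank (x ∷ us) b ≤ length R → ¬ Frozen X (x ∷ us) b) ×
                                      (¬ Frozen X (x ∷ us) b → rank (x ∷ us) b ≤ length R)))
  active {x} {[]} start _ _ (add [] i) _ =
    [] , Ins-[] i , λ b → (λ { _ (later ()) }) , λ _ → rank≤length (x ∷ []) b
  active {x} {z ∷ us} (asc {ρ = ρ} r a i) refl refl (add τ j) (_ ∷ d) with active r refl refl τ d
  ... | F , refl , inv with Ins-extend i F j
  ...   | F′ , eq = F′ , eq , λ b → let p , q = rank-step b (Ins-gap≤ i) in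
      (λ le → λ { (now δ _) → asc-desc X a δ ; (later f) → proj₁ (inv b) (p (≤-trans le (≤-reflexive (Ins-length i)))) f }) ,
      λ nf → ≤-trans (q (proj₂ (inv b) λ f → nf (later f))) (≤-reflexive (sym (Ins-length i)))
  active {x} {z ∷ us} (small r a s i) refl refl (add τ j) (_ ∷ d) with active r refl refl τ d
  ... | F , refl , inv with Ins-extend i F j
  ...   | F′ , eq = F′ , eq , λ b → let p , q = rank-step b (Ins-gap≤ i) in
      (λ le → λ { (now _ big) → ¬Big τ d F b refl s (p (≤-trans le (≤-reflexive (Ins-length i)))) big
                ; (later f) → proj₁ (inv b) (p (≤-trans le (≤-reflexive (Ins-length i)))) f }) ,
      λ nf → ≤-trans (q (proj₂ (inv b) λ f → nf (later f))) (≤-reflexive (sym (Ins-length i)))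
  active {x} {z ∷ us} (cut E {Q} r a refl cq i _) refl refl (add τ j) (_ ∷ d) with active r refl refl τ d
  ... | F , refl , inv with Ins-extend i (F ++ E ++ letter X ∷ []) (subst (λ w → Ins w _ _ _) (++-regroup F E (letter X ∷ [])) j)
  ...   | F′ , eq = F′ , eq , λ b → let p , q = rank-step b (Ins-gap≤ i) in
      (λ le → λ { (now _ big) → ¬Big τ d (F ++ E ++ letter X ∷ []) b
                                  (++-regroup F E (letter X ∷ []))
                                  (≤-reflexive cq) (p (≤-trans le (≤-reflexive (Ins-length i)))) big
                ; (later f) → proj₁ (inv b) (≤-trans (p (≤-trans le (≤-reflexive (Ins-length i))))
                                (≤-trans (n≤1+n _) (length-++-≤ E (letter X ∷ Q)))) f }) ,
      λ nf → ≤-trans (q (≮⇒≥ λ lt → nf (now a (cut-Big τ d (F ++ E) b (sym (++-assoc F E (letter X ∷ Q))) cq lt))))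
               (≤-reflexive (sym (Ins-length i)))

-- An occurrence of Q_k can be moved so that its last two entries are adjacent.
Peak : Side → ℕ → ℕ → List ℕ → Set
Peak (rows κ) x z us = Desc (rows κ) (rank us z) (rank (z ∷ us) x) × Has _<_ (z ∷ us) (suc κ) (_< x)
Peak (cols κ) x z us = ⊥

data Good (X : Side) : List ℕ → Set where
  one : ∀ {x} → Good X (x ∷ [])
  more : ∀ {x z us} → Good X (z ∷ us) → ¬ Frozen X (x ∷ z ∷ us) x → ¬ Peak X x z us → Good X (x ∷ z ∷ us)

rank-self : ∀ us x → rank (x ∷ us) x ≡ rank us x
rank-self us x = rank-≥ us ≤-refl

-- By rows, a new cell in row 0 means that `suc κ` entries of the first row lie below `x`, hence a
-- chain of k - 2 entries below the lower end of a descent. By columns, the last insertion ended in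
-- column `κ` as seen on `Q`, and a descent goes no further.
cut-fresh : ∀ X {x z us w R ρ E Q R₁ ρ₁} → Tab (z ∷ us) w → ∀ F → w ≡ F ++ R → Run X (rank us z) (codes us) R ρ →
            Desc X (rank us z) (rank (z ∷ us) x) → R ≡ E ++ letter X ∷ Q → cnt Q (letter X) ≡ height X →
            Ins Q (rank (z ∷ us) x) R₁ ρ₁ → ¬ Peak X x z us → ρ₁ ≢ letter X
cut-fresh (rows κ) {x} {E = E} {Q} τ F refl r a refl cq i np refl with split-bottom Q (Ins-gap≤ i)
... | G , B , refl , lenB = np (a , proj₁ (lis τ (F ++ E ++ 0 ∷ G) x (++-regroup F E (0 ∷ G)) lenB (suc κ))
                                      (≤-reflexive (trans (sym cq) (Ins-zero i G refl lenB))))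
cut-fresh (cols κ) {E = E} τ F eq r a eqR cq i np refl with Run-cols-cut r E eqR cq
... | _ , j = contradiction (bump-hi j i a) 1+n≰n

Good-Run : ∀ X {x us} → Distinct (x ∷ us) → Good X (x ∷ us) → ∃₂ λ R ρ → Run X (rank us x) (codes us) R ρ
Good-Run X {x} _ one rewrite rank-[] x = _ , _ , start
Good-Run X {x} {z ∷ us} (_ ∷ d) (more g nf np) with Good-Run X d g | Tab-total (z ∷ us)
... | R , ρ , r | w , τ with active X r refl refl τ d | asc? X (rank us z) (rank (z ∷ us) x)
...   | F , eq , inv | inj₁ a with Ins-total R (proj₂ (inv x) λ f → nf (later f))
...     | R₁ , ρ₁ , i = R₁ , ρ₁ , asc r a i
Good-Run X {x} {z ∷ us} (_ ∷ d) (more g nf np) | R , ρ , r | w , τ | F , eq , inv | inj₂ a with cnt R (letter X) ≤? height X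
... | yes s with Ins-total R (proj₂ (inv x) λ f → nf (later f))
...   | R₁ , ρ₁ , i = R₁ , ρ₁ , small r a s i
Good-Run X {x} {z ∷ us} (_ ∷ d) (more g nf np) | R , ρ , r | w , τ | F , eq , inv | inj₂ a | no ≰ with find-cut R (≰⇒> ≰)
... | E , Q , refl , cq with Ins-total Q (≮⇒≥ λ lt → nf (now a (cut-Big X τ d (F ++ E) x (trans eq (sym (++-assoc F E _))) cq lt)))
...   | R₁ , ρ₁ , i = R₁ , ρ₁ , cut E r a refl cq i (cut-fresh X τ F eq r a refl cq i np)

-- The upper entry `z` of the descent would complete the k - 2 entries below `x` to a chain of k - 1
-- entries below `suc z`. As `z` is still active, the first row would reach column k - 1.
¬Peak-small : ∀ X {x z us w R ρ} → Tab (z ∷ us) w → Distinct (z ∷ us) → ∀ F → w ≡ F ++ R → Run X (rank us z) (codes us) R ρ →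
              cnt R (letter X) ≤ height X → ¬ Peak X x z us
¬Peak-small (rows κ) {x} {z} {us} {R = R} τ (dz ∷ d) F eq r s (a , h) =
  ¬Big (rows κ) τ (dz ∷ d) F (suc z) eq s top (big h)
  where
  x≤z : x ≤ z
  x≤z = ≮⇒≥ λ lt → <⇒≱ (≤-trans (s≤s (rank-mono us (<⇒≤ lt))) (≤-reflexive (sym (rank-< us lt)))) a
  top : rank (z ∷ us) (suc z) ≤ length R
  top with Run-last r
  ... | _ , i , _ = ≤-trans (≤-reflexive (trans (rank-< us ≤-refl) (cong suc (rank-suc dz))))
                      (≤-trans (s≤s (Ins-gap≤ i)) (≤-reflexive (sym (Ins-length i))))
  big : Has _<_ (z ∷ us) (suc κ) (_< x) → Has _<_ (z ∷ us) (suc (suc κ)) (_< suc z)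
  big (inj₁ h) = inj₂ (≤-refl , Has-map us (suc κ) (λ lt → m≤n⇒m≤1+n (<-≤-trans lt x≤z) , <-≤-trans lt x≤z) h)
  big (inj₂ (z<x , _)) = contradiction x≤z (<⇒≱ z<x)

¬Peak-cut : ∀ X {x z us w R E Q R₁ ρ₁} → Tab (z ∷ us) w → ∀ F → w ≡ F ++ R →
            R ≡ E ++ letter X ∷ Q → cnt Q (letter X) ≡ height X →
            Ins Q (rank (z ∷ us) x) R₁ ρ₁ → ρ₁ ≢ letter X → ¬ Peak X x z us
¬Peak-cut (rows κ) {x} {E = E} {Q} τ F refl refl cq i ≢0 (a , h) with split-bottom Q (Ins-gap≤ i)
... | G , B , refl , lenB = <⇒≱ (Ins-nonzero i ≢0 G refl lenB)
        (≤-trans (≤-reflexive cq) (proj₂ (lis τ (F ++ E ++ 0 ∷ G) x (++-regroup F E (0 ∷ G)) lenB (suc κ)) h))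

¬Peak-asc : ∀ X {x z us} → Asc X (rank us z) (rank (z ∷ us) x) → ¬ Peak X x z us
¬Peak-asc (rows κ) a (δ , _) = asc-desc (rows κ) a δ

Run-Good : ∀ X {x us e es R ρ} → Distinct (x ∷ us) → Run X e es R ρ → e ≡ rank us x → es ≡ codes us → Good X (x ∷ us)
Run-Good X {x} {[]} _ _ _ _ = one
Run-Good X {x} {z ∷ us} {R = R} d r refl refl with Tab-total (x ∷ z ∷ us)
... | w , τ = go r d (active X r refl refl τ d)
  where
  -- The entry `x` has just been inserted into the active part, so `active` shows that it is not
  -- frozen.
  below : rank (x ∷ z ∷ us) x ≤ length R
  below with Run-last r
  ... | _ , i , _ = ≤-trans (≤-reflexive (rank-self (z ∷ us) x))
                      (≤-trans (m≤n⇒m≤1+n (Ins-gap≤ i)) (≤-reflexive (sym (Ins-length i))))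
  go : ∀ {ρ} → Run X (rank (z ∷ us) x) (codes (z ∷ us)) R ρ → Distinct (x ∷ z ∷ us) → _ → Good X (x ∷ z ∷ us)
  go (asc r₀ a i) (_ ∷ d₀) (_ , _ , inv) = more (Run-Good X d₀ r₀ refl refl) (proj₁ (inv x) below) (¬Peak-asc X a)
  go (small r₀ a s i) (_ ∷ d₀) (_ , _ , inv) with Tab-total (z ∷ us)
  ... | w₀ , τ₀ with active X r₀ refl refl τ₀ d₀
  ...   | F , eq , _ = more (Run-Good X d₀ r₀ refl refl) (proj₁ (inv x) below) (¬Peak-small X τ₀ d₀ F eq r₀ s)
  go (cut E r₀ a eqR cq i ≢) (_ ∷ d₀) (_ , _ , inv) with Tab-total (z ∷ us)
  ... | w₀ , τ₀ with active X r₀ refl refl τ₀ d₀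
  ...   | F , eq , _ = more (Run-Good X d₀ r₀ refl refl) (proj₁ (inv x) below) (¬Peak-cut X {E = E} τ₀ F eq eqR cq i ≢)

-- Permutations and Lehmer codes

-- Latest entry first, as for runs.
word : ∀ {n} → (Fin n → ℕ) → List ℕ
word {zero} v = []
word {suc n} v = v (fromℕ n) ∷ word (v ∘ inject₁)

word-cong : ∀ {n} {v w : Fin n → ℕ} → (∀ i → v i ≡ w i) → word v ≡ word w
word-cong {zero} eq = refl
word-cong {suc n} eq = cong₂ _∷_ (eq _) (word-cong (eq ∘ inject₁))

word-map : ∀ {n} (f : ℕ → ℕ) (v : Fin n → ℕ) → word (f ∘ v) ≡ map f (word v)
word-map {zero} f v = refl
word-map {suc n} f v = cong (f (v (fromℕ n)) ∷_) (word-map f (v ∘ inject₁))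

rank-map : ∀ {f : ℕ → ℕ} {b b′} → (∀ {y} → y < b → f y < b′) → (∀ {y} → f y < b′ → y < b) →
           ∀ us → rank (map f us) b′ ≡ rank us b
rank-map p q [] = trans (rank-[] _) (sym (rank-[] _))
rank-map {f} {b} p q (y ∷ us) with y <? b
... | yes lt = trans (rank-< (map f us) (p lt)) (trans (cong suc (rank-map p q us)) (sym (rank-< us lt)))
... | no ≮ = trans (rank-≥ (map f us) (≮⇒≥ (≮ ∘ q))) (trans (rank-map p q us) (sym (rank-≥ us (≮⇒≥ ≮))))

codes-map : ∀ {f : ℕ → ℕ} → (∀ {x y} → y < x → f y < f x) → (∀ {x y} → f y < f x → y < x) →
            ∀ us → codes (map f us) ≡ codes us
codes-map p q [] = refl
codes-map p q (x ∷ us) = cong₂ _∷_ (rank-map p q us) (codes-map p q us)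

opaque
  lift : ℕ → ℕ → ℕ
  lift e v with v <? e
  ... | yes _ = v
  ... | no _ = suc v

  lift-< : ∀ {e v} → v < e → lift e v ≡ v
  lift-< {e} {v} lt with v <? e
  ... | yes _ = refl
  ... | no ≮ = contradiction lt ≮

  lift-≥ : ∀ {e v} → e ≤ v → lift e v ≡ suc v
  lift-≥ {e} {v} le with v <? e
  ... | yes lt = contradiction lt (≤⇒≯ le)
  ... | no _ = refl

lift-suc : ∀ e v → lift (suc e) (suc v) ≡ suc (lift e v)
lift-suc e v with v <? e
... | yes lt = trans (lift-< (s≤s lt)) (cong suc (sym (lift-< lt)))
... | no ≮ = trans (lift-≥ (s≤s (≮⇒≥ ≮))) (cong suc (sym (lift-≥ (≮⇒≥ ≮))))

toℕ-punchIn : ∀ {n} (i : Fin (suc n)) j → toℕ (punchIn i j) ≡ lift (toℕ i) (toℕ j)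
toℕ-punchIn Fin.zero j = sym (lift-≥ z≤n)
toℕ-punchIn (Fin.suc i) Fin.zero = sym (lift-< z<s)
toℕ-punchIn (Fin.suc i) (Fin.suc j) = trans (cong suc (toℕ-punchIn i j)) (sym (lift-suc (toℕ i) (toℕ j)))

lift-mono : ∀ e {x y} → y < x → lift e y < lift e x
lift-mono e {x} {y} lt with x <? e | y <? e
... | yes p | yes q rewrite lift-< p | lift-< q = lt
... | yes p | no q = contradiction (<-trans lt p) q
... | no p | yes q rewrite lift-≥ (≮⇒≥ p) | lift-< q = m≤n⇒m≤1+n lt
... | no p | no q rewrite lift-≥ (≮⇒≥ p) | lift-≥ (≮⇒≥ q) = s≤s lt

mono⇒reflects : ∀ {f : ℕ → ℕ} → (∀ {x y} → y < x → f y < f x) → ∀ {x y} → f y < f x → y < x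
mono⇒reflects {f} p {x} {y} lt = ≰⇒> λ x≤y → case (m≤n⇒m<n∨m≡n x≤y) lt
  where
  case : x < y ⊎ x ≡ y → f y < f x → ⊥
  case (inj₁ x<y) lt = <-asym (p x<y) lt
  case (inj₂ refl) lt = <-irrefl refl lt

lift-below : ∀ {e b y} → b ≤ e → y < b → lift e y < b
lift-below b≤e y<b = subst (_< _) (sym (lift-< (<-≤-trans y<b b≤e))) y<b

lift-below⁻ : ∀ {e b y} → b ≤ e → lift e y < b → y < b
lift-below⁻ {e} {b} {y} b≤e lt with y <? e
... | yes y<e = subst (_< b) (lift-< y<e) lt
... | no ≮ = contradiction (<-≤-trans (subst (_< b) (lift-≥ (≮⇒≥ ≮)) lt) b≤e) (≤⇒≯ (m≤n⇒m≤1+n (≮⇒≥ ≮)))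

lift-above : ∀ {e b y} → e ≤ b → y < b → lift e y < suc b
lift-above {e} {b} {y} e≤b y<b with y <? e
... | yes y<e = subst (_< suc b) (sym (lift-< y<e)) (m≤n⇒m≤1+n y<b)
... | no ≮ = subst (_< suc b) (sym (lift-≥ (≮⇒≥ ≮))) (s≤s y<b)

lift-above⁻ : ∀ {e b y} → e ≤ b → lift e y < suc b → y < b
lift-above⁻ {e} {b} {y} e≤b lt with y <? e
... | yes y<e = <-≤-trans y<e e≤b
... | no ≮ = ≤-pred (subst (_< suc b) (lift-≥ (≮⇒≥ ≮)) lt)

punchIn-last : ∀ n (j : Fin n) → punchIn (fromℕ n) j ≡ inject₁ j
punchIn-last (suc n) Fin.zero = refl
punchIn-last (suc n) (Fin.suc j) = cong Fin.suc (punchIn-last n j)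

permute-inject₁ : ∀ {n} (π : Perm (suc n)) j →
                  π ⟨$⟩ʳ inject₁ j ≡ punchIn (π ⟨$⟩ʳ fromℕ n) (remove (fromℕ n) π ⟨$⟩ʳ j)
permute-inject₁ {n} π j = trans (cong (π ⟨$⟩ʳ_) (sym (punchIn-last n j))) (punchIn-permute π (fromℕ n) j)

word-remove : ∀ {n} (π : Perm (suc n)) →
              word (val π) ≡ val π (fromℕ n) ∷ map (lift (val π (fromℕ n))) (word (val (remove (fromℕ n) π)))
word-remove {n} π = cong (val π (fromℕ n) ∷_) (trans
  (word-cong λ j → trans (cong toℕ (permute-inject₁ π j)) (toℕ-punchIn (π ⟨$⟩ʳ fromℕ n) _))
  (word-map (lift (val π (fromℕ n))) (val (remove (fromℕ n) π))))

rank-word : ∀ {n} (π : Perm n) b → b ≤ n → rank (word (val π)) b ≡ b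
rank-word {zero} π zero z≤n = rank-[] 0
rank-word {suc n} π b b≤ rewrite word-remove π with val π (fromℕ n) <? b
rank-word {suc n} π (suc b) b≤ | yes (s≤s e≤b) = trans (rank-< _ (s≤s e≤b)) (cong suc
  (trans (rank-map (lift-above e≤b) (lift-above⁻ e≤b) (word (val (remove (fromℕ n) π)))) (rank-word (remove (fromℕ n) π) b (≤-pred b≤))))
... | no ≮ = trans (rank-≥ _ (≮⇒≥ ≮))
  (trans (rank-map (lift-below (≮⇒≥ ≮)) (lift-below⁻ (≮⇒≥ ≮)) (word (val (remove (fromℕ n) π))))
         (rank-word (remove (fromℕ n) π) b (≤-trans (≮⇒≥ ≮) (≤-pred (toℕ<n (π ⟨$⟩ʳ fromℕ n))))))

code : ∀ {n} → Perm n → List ℕ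
code π = codes (word (val π))

-- All values smaller than the last one occur before it, so the last value is its own code.
code-remove : ∀ {n} (π : Perm (suc n)) → code π ≡ val π (fromℕ n) ∷ code (remove (fromℕ n) π)
code-remove {n} π = trans (cong codes (word-remove π)) (cong₂ _∷_
  (trans (rank-map (lift-below ≤-refl) (lift-below⁻ ≤-refl) (word (val (remove (fromℕ n) π))))
         (rank-word (remove (fromℕ n) π) _ (≤-pred (toℕ<n (π ⟨$⟩ʳ fromℕ n)))))
  (codes-map (λ {x} {y} → lift-mono e {x} {y}) (mono⇒reflects (λ {x} {y} → lift-mono e {x} {y})) (word (val (remove (fromℕ n) π)))))
  where e = val π (fromℕ n)

code-cong : ∀ {n} {π σ : Perm n} → π ≈ₚ σ → code π ≡ code σ
code-cong eq = cong codes (word-cong λ i → cong toℕ (eq i))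

last-or-inject₁ : ∀ {n} {P : Fin (suc n) → Set} → P (fromℕ n) → (∀ j → P (inject₁ j)) → ∀ i → P i
last-or-inject₁ {zero} p q Fin.zero = p
last-or-inject₁ {suc n} p q Fin.zero = q Fin.zero
last-or-inject₁ {suc n} {P} p q (Fin.suc i) = last-or-inject₁ {n} {P ∘ Fin.suc} p (q ∘ Fin.suc) i

code-injective : ∀ {n} (π σ : Perm n) → code π ≡ code σ → π ≈ₚ σ
code-injective {zero} π σ _ ()
code-injective {suc n} π σ eq with ∷-injective (trans (sym (code-remove π)) (trans eq (code-remove σ)))
... | p , q = last-or-inject₁ (toℕ-injective p) λ j →
  trans (permute-inject₁ π j) (trans (cong₂ punchIn (toℕ-injective p) (code-injective (remove (fromℕ n) π) (remove (fromℕ n) σ) q j))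
    (sym (permute-inject₁ σ j)))

data Lehmer : List ℕ → Set where
  [] : Lehmer []
  _∷_ : ∀ {e es} → e ≤ length es → Lehmer es → Lehmer (e ∷ es)

insert-last : ∀ {n} i j (π : Perm n) → insert i j π ⟨$⟩ʳ i ≡ j
insert-last i j π with i Fin.≟ i
... | yes _ = refl
... | no i≢i = contradiction refl i≢i

opaque
  decode : ∀ {n es} → length es ≡ n → Lehmer es → ∃[ π ] code {n} π ≡ es
  decode {zero} {[]} refl [] = id , refl
  decode {suc n} {e ∷ es} len (le ∷ ls) with decode {n} (suc-injective len) ls
  ... | π , eq = σ , trans (code-remove σ) (cong₂ _∷_
      (trans (cong toℕ (insert-last (fromℕ n) (fromℕ< e<) π)) (toℕ-fromℕ< e<))
      (trans (code-cong {π = remove (fromℕ n) σ} {π} (remove-insert (fromℕ n) (fromℕ< e<) π)) eq))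
    where
    e< : e < suc n
    e< = s≤s (≤-trans le (≤-reflexive (suc-injective len)))
    σ : Perm (suc n)
    σ = insert (fromℕ n) (fromℕ< e<) π

Run-length : ∀ {X e es R ρ} → Run X e es R ρ → length R ≤ suc (length es)
Run-length start = ≤-refl
Run-length (asc r _ i) = ≤-trans (≤-reflexive (Ins-length i)) (s≤s (Run-length r))
Run-length (small r _ _ i) = ≤-trans (≤-reflexive (Ins-length i)) (s≤s (Run-length r))
Run-length (cut E r _ refl _ i _) =
  ≤-trans (≤-reflexive (Ins-length i)) (s≤s (≤-trans (≤-trans (n≤1+n _) (length-++-≤ E _)) (Run-length r)))

Run-Lehmer : ∀ {X e es R ρ} → Run X e es R ρ → Lehmer (e ∷ es)
Run-Lehmer r = bound r ∷ rest r
  where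
  bound : ∀ {X e es R ρ} → Run X e es R ρ → e ≤ length es
  bound r with Run-last r
  ... | _ , i , _ = ≤-trans (Ins-gap≤ i) (≤-pred (≤-trans (≤-reflexive (sym (Ins-length i))) (Run-length r)))
  rest : ∀ {X e es R ρ} → Run X e es R ρ → Lehmer es
  rest start = []
  rest (asc r _ _) = Run-Lehmer r
  rest (small r _ _ _) = Run-Lehmer r
  rest (cut _ r _ _ _ _ _) = Run-Lehmer r

-- Patterns

opaque
  ext : ∀ {n} → (Fin n → ℕ) → ℕ → ℕ
  ext {n} v p with p <? n
  ... | yes lt = v (fromℕ< lt)
  ... | no _ = 0

  ext-fromℕ< : ∀ {n} (v : Fin n → ℕ) {p} (lt : p < n) → ext v p ≡ v (fromℕ< lt)
  ext-fromℕ< {n} v {p} lt with p <? n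
  ... | yes _ = refl
  ... | no ≮ = contradiction lt ≮

ext-toℕ : ∀ {n} (v : Fin n → ℕ) i → ext v (toℕ i) ≡ v i
ext-toℕ v i = trans (ext-fromℕ< v (toℕ<n i)) (cong v (fromℕ<-toℕ i (toℕ<n i)))

pre : (ℕ → ℕ) → ℕ → List ℕ
pre v zero = []
pre v (suc j) = v j ∷ pre v j

word≡pre : ∀ {n} (v : Fin n → ℕ) w → (∀ i → w (toℕ i) ≡ v i) → word v ≡ pre w n
word≡pre {zero} v w eq = refl
word≡pre {suc n} v w eq = cong₂ _∷_
  (trans (sym (eq (fromℕ n))) (cong w (toℕ-fromℕ n)))
  (word≡pre (v ∘ inject₁) w λ i → trans (cong w (sym (toℕ-inject₁ i))) (eq (inject₁ i)))

-- Chains as increasing sequences of positions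

record Pos (_≺_ : ℕ → ℕ → Set) (v : ℕ → ℕ) (j r : ℕ) (S : ℕ → Set) : Set where
  field
    pos   : ℕ → ℕ
    pos<  : ∀ {i} → i < r → pos i < j
    pos-≺ : ∀ {i i′} → i < i′ → i′ < r → pos i < pos i′ × v (pos i) ≺ v (pos i′)
    pos-S : ∀ {i} → i < r → S (v (pos i))
open Pos

opaque
  splice : (ℕ → ℕ) → ℕ → ℕ → ℕ → ℕ
  splice g r j i with i <? r
  ... | yes _ = g i
  ... | no _ = j

  splice-< : ∀ g {r j i} → i < r → splice g r j i ≡ g i
  splice-< g {r} {j} {i} lt with i <? r
  ... | yes _ = refl
  ... | no ≮ = contradiction lt ≮

  splice-≥ : ∀ g {r j i} → r ≤ i → splice g r j i ≡ j
  splice-≥ g {r} {j} {i} le with i <? r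
  ... | yes lt = contradiction lt (≤⇒≯ le)
  ... | no _ = refl

<suc-cases : ∀ {i r} → i < suc r → i < r ⊎ i ≡ r
<suc-cases lt = m≤n⇒m<n∨m≡n (≤-pred lt)

module _ {_≺_ : ℕ → ℕ → Set} {v : ℕ → ℕ} where

  Has⇒Pos : ∀ j r {S} → Has _≺_ (pre v j) r S → Pos _≺_ v j r S
  Has⇒Pos j zero h = record { pos = λ _ → 0 ; pos< = λ () ; pos-≺ = λ _ () ; pos-S = λ () }
  Has⇒Pos (suc j) (suc r) (inj₁ h) = record { pos = pos p ; pos< = λ lt → m≤n⇒m≤1+n (pos< p lt) ; pos-≺ = pos-≺ p ; pos-S = pos-S p }
    where p = Has⇒Pos j (suc r) h
  Has⇒Pos (suc j) (suc r) {S} (inj₂ (s , h)) = record { pos = g ; pos< = below ; pos-≺ = rel ; pos-S = inS }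
    where
    p = Has⇒Pos j r h
    g = splice (pos p) r j
    below : ∀ {i} → i < suc r → g i < suc j
    below {i} lt with <suc-cases lt
    ... | inj₁ lt′ rewrite splice-< (pos p) {r} {j} lt′ = m≤n⇒m≤1+n (pos< p lt′)
    ... | inj₂ refl rewrite splice-≥ (pos p) {r} {j} {r} ≤-refl = ≤-refl
    rel : ∀ {i i′} → i < i′ → i′ < suc r → g i < g i′ × v (g i) ≺ v (g i′)
    rel {i} {i′} lt lt′ with <suc-cases lt′
    ... | inj₁ lt″ rewrite splice-< (pos p) {r} {j} lt″ | splice-< (pos p) {r} {j} (<-trans lt lt″) = pos-≺ p lt lt″
    ... | inj₂ refl rewrite splice-≥ (pos p) {r} {j} {r} ≤-refl | splice-< (pos p) {r} {j} lt = pos< p lt , proj₂ (pos-S p lt)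
    inS : ∀ {i} → i < suc r → S (v (g i))
    inS {i} lt with <suc-cases lt
    ... | inj₁ lt′ rewrite splice-< (pos p) {r} {j} lt′ = proj₁ (pos-S p lt′)
    ... | inj₂ refl rewrite splice-≥ (pos p) {r} {j} {r} ≤-refl = s

  Pos⇒Has : ∀ j r {S} → Pos _≺_ v j r S → Has _≺_ (pre v j) r S
  Pos⇒Has j zero p = tt
  Pos⇒Has zero (suc r) p = contradiction (pos< p ≤-refl) n≮0
  Pos⇒Has (suc j) (suc r) {S} p with pos p r ≟ j
  ... | yes eq = inj₂ (subst (S ∘ v) eq (pos-S p ≤-refl) , Pos⇒Has j r (record
          { pos = pos p
          ; pos< = λ lt → <-≤-trans (proj₁ (pos-≺ p lt ≤-refl)) (≤-reflexive eq)
          ; pos-≺ = λ lt lt′ → pos-≺ p lt (m≤n⇒m≤1+n lt′)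
          ; pos-S = λ {i} lt → pos-S p (m≤n⇒m≤1+n lt) , subst (λ q → v (pos p i) ≺ v q) eq (proj₂ (pos-≺ p lt ≤-refl)) }))
  ... | no ≢j = inj₁ (Pos⇒Has j (suc r) (record
          { pos = pos p ; pos< = below ; pos-≺ = pos-≺ p ; pos-S = pos-S p }))
    where
    last< : pos p r < j
    last< = ≤∧≢⇒< (≤-pred (pos< p ≤-refl)) ≢j
    below : ∀ {i} → i < suc r → pos p i < j
    below lt with <suc-cases lt
    ... | inj₁ lt′ = <-trans (proj₁ (pos-≺ p lt′ ≤-refl)) last<
    ... | inj₂ refl = last<

Sep : (ℕ → ℕ) → ℕ → Set
Sep v n = ∀ {p q} → p < q → q < n → v p ≢ v q

Sep-pre : ∀ {v n} → Sep v n → ∀ j → j ≤ n → Distinct (pre v j)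
Sep-pre s zero _ = []
Sep-pre {v} s (suc j) le = apart j ≤-refl ∷ Sep-pre s j (<⇒≤ le)
  where
  apart : ∀ i → i ≤ j → All (v j ≢_) (pre v i)
  apart zero _ = []
  apart (suc i) lt = (λ eq → s lt le (sym eq)) ∷ apart i (<⇒≤ lt)

DescAt : Side → (ℕ → ℕ) → ℕ → Set
DescAt X v j = Desc X (rank (pre v j) (v j)) (rank (pre v (suc j)) (v (suc j)))

Drop : Side → (ℕ → ℕ) → ℕ → Set
Drop (rows _) v j = v (suc j) < v j
Drop (cols _) v j = v j < v (suc j)

private
  rank-rise : ∀ {x z} us → z < x → rank us z < rank (z ∷ us) x
  rank-rise us lt = ≤-trans (s≤s (rank-mono us (<⇒≤ lt))) (≤-reflexive (sym (rank-< us lt)))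

  rank-drop : ∀ {x z} us → x < z → rank (z ∷ us) x ≤ rank us z
  rank-drop us lt = ≤-trans (≤-reflexive (rank-≥ us (<⇒≤ lt))) (rank-mono us (<⇒≤ lt))

DescAt⇒Drop : ∀ X {v n j} → Sep v n → suc j < n → DescAt X v j → Drop X v j
DescAt⇒Drop (rows _) {v} {n} {j} s lt d with <-cmp (v (suc j)) (v j)
... | tri< p _ _ = p
... | tri≈ _ eq _ = contradiction (sym eq) (s ≤-refl lt)
... | tri> _ _ gt = contradiction d (<⇒≱ (rank-rise (pre v j) gt))
DescAt⇒Drop (cols _) {v} {n} {j} s lt d with <-cmp (v (suc j)) (v j)
... | tri< p _ _ = contradiction (rank-drop (pre v j) p) (<⇒≱ d)
... | tri≈ _ eq _ = contradiction (sym eq) (s ≤-refl lt)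
... | tri> _ _ gt = gt

Drop⇒DescAt : ∀ X {v j} → Drop X v j → DescAt X v j
Drop⇒DescAt (rows _) {v} {j} = rank-drop (pre v j)
Drop⇒DescAt (cols _) {v} {j} = rank-rise (pre v j)

module _ (X : Side) {v : ℕ → ℕ} where

  Frozen⇒ : ∀ m {b} → Frozen X (pre v m) b → ∃[ j ] (suc j < m × DescAt X v j × Big X (pre v (suc j)) b)
  Frozen⇒ (suc zero) (later ())
  Frozen⇒ (suc (suc m)) (now d big) = m , ≤-refl , d , big
  Frozen⇒ (suc (suc m)) (later f) with Frozen⇒ (suc m) f
  ... | j , lt , d , big = j , m≤n⇒m≤1+n lt , d , big

  ⇒Frozen : ∀ m {b j} → suc j < m → DescAt X v j → Big X (pre v (suc j)) b → Frozen X (pre v m) b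
  ⇒Frozen (suc m) (s≤s lt) d big with m≤n⇒m<n∨m≡n lt
  ... | inj₁ lt′ = later (⇒Frozen m lt′ d big)
  ... | inj₂ refl = now d big

  Good⇒ : ∀ m → Good X (pre v (suc m)) → ∀ {j} → j < m →
          ¬ Frozen X (pre v (suc (suc j))) (v (suc j)) × ¬ Peak X (v (suc j)) (v j) (pre v j)
  Good⇒ (suc m) (more g nf np) lt with <suc-cases lt
  ... | inj₁ lt′ = Good⇒ m g lt′
  ... | inj₂ refl = nf , np

  ⇒Good : ∀ m → (∀ {j} → j < m → ¬ Frozen X (pre v (suc (suc j))) (v (suc j)) × ¬ Peak X (v (suc j)) (v j) (pre v j)) →
          Good X (pre v (suc m))
  ⇒Good zero _ = one
  ⇒Good (suc m) h = more (⇒Good m λ lt → h (m≤n⇒m≤1+n lt)) (proj₁ (h ≤-refl)) (proj₂ (h ≤-refl))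

record Occ (τ : ℕ → ℕ) (k n : ℕ) (v g : ℕ → ℕ) : Set where
  field
    bound : ∀ {i} → i < k → g i < n
    incr  : ∀ {i i′} → i < i′ → i′ < k → g i < g i′
    order : ∀ {i i′} → i < k → i′ < k → τ i < τ i′ → v (g i) < v (g i′)
open Occ

private
  at : ∀ {k} {P : ℕ → Set} → (∀ (a : Fin k) → P (toℕ a)) → ∀ {i} → i < k → P i
  at {P = P} h lt = subst P (toℕ-fromℕ< lt) (h (fromℕ< lt))

Occurrence⇒Occ : ∀ {τ k n} {π : Perm n} {f} → Occurrence {k} (τ ∘ toℕ) π f → Occ τ k n (ext (val π)) (ext (toℕ ∘ f))
Occurrence⇒Occ {τ} {k} {n} {π} {f} (si , oi) = record
  { bound = at λ a → subst (_< n) (sym (fa a)) (toℕ<n (f a))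
  ; incr = λ {i} {i′} lt lt′ → at {P = λ i → i < i′ → g i < g i′}
      (λ a → at {P = λ i′ → toℕ a < i′ → g (toℕ a) < g i′} (λ b lt → subst₂ _<_ (sym (fa a)) (sym (fa b)) (si a b lt)) lt′) (<-trans lt lt′) lt
  ; order = λ {i} {i′} lt lt′ → at {P = λ i → τ i < τ i′ → w (g i) < w (g i′)}
      (λ a → at {P = λ i′ → τ (toℕ a) < τ i′ → w (g (toℕ a)) < w (g i′)} (λ b lt → subst₂ _<_ (sym (va a)) (sym (va b)) (proj₁ (oi a b) lt)) lt′) lt }
  where
  g = ext (toℕ ∘ f)
  w = ext (val π)
  fa : ∀ a → g (toℕ a) ≡ toℕ (f a)
  fa = ext-toℕ (toℕ ∘ f)
  va : ∀ a → w (g (toℕ a)) ≡ val π (f a)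
  va a = trans (cong w (fa a)) (ext-toℕ (val π) (f a))

Occ⇒Occurrence : ∀ {τ k n} {π : Perm n} {g} → (∀ {i i′} → i < k → i′ < k → τ i ≡ τ i′ → i ≡ i′) →
                 Occ τ k n (ext (val π)) g → ∃[ f ] (Occurrence {k} (τ ∘ toℕ) π f × (∀ a → toℕ (f a) ≡ g (toℕ a)))
Occ⇒Occurrence {τ} {k} {n} {π} {g} inj o = f , (si , oi) , fa
  where
  f : Fin k → Fin n
  f a = fromℕ< (bound o (toℕ<n a))
  fa : ∀ a → toℕ (f a) ≡ g (toℕ a)
  fa a = toℕ-fromℕ< (bound o (toℕ<n a))
  va : ∀ a → ext (val π) (g (toℕ a)) ≡ val π (f a)
  va a = ext-fromℕ< (val π) (bound o (toℕ<n a))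
  si : StrictIncr f
  si a b lt = subst₂ _<_ (sym (fa a)) (sym (fa b)) (incr o lt (toℕ<n b))
  fwd : ∀ a b → τ (toℕ a) < τ (toℕ b) → val π (f a) < val π (f b)
  fwd a b lt = subst₂ _<_ (va a) (va b) (order o (toℕ<n a) (toℕ<n b) lt)
  oi : OrderIso (τ ∘ toℕ) π f
  oi a b = fwd a b , bwd
    where
    bwd : val π (f a) < val π (f b) → τ (toℕ a) < τ (toℕ b)
    bwd lt with <-cmp (τ (toℕ a)) (τ (toℕ b))
    ... | tri< p _ _ = p
    ... | tri> _ _ gt = contradiction lt (<-asym (fwd b a gt))
    ... | tri≈ _ eq _ with toℕ-injective {i = a} {b} (inj (toℕ<n a) (toℕ<n b) eq)
    ...   | refl = contradiction lt (<-irrefl refl)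

private
  if-≡ : ∀ {a b : ℕ} m n → m ≡ n → (if m ≡ᵇ n then a else b) ≡ a
  if-≡ m n eq with m ≡ᵇ n | ≡⇒≡ᵇ m n eq
  ... | true | _ = refl

  if-≢ : ∀ {a b : ℕ} m n → m ≢ n → (if m ≡ᵇ n then a else b) ≡ b
  if-≢ m n ne with m ≡ᵇ n | ≡ᵇ⇒≡ m n
  ... | true | h = contradiction (h tt) ne
  ... | false | _ = refl

τF : ℕ → ℕ → ℕ
τF k i = if (i + 1 ≡ᵇ k) then 1 else i + 2

τG : ℕ → ℕ → ℕ
τG k i = if (i + 2 ≡ᵇ k) then k else (if (i + 1 ≡ᵇ k) then k ∸ 1 else i + 1)

τF-init : ∀ {r i} → i < r → τF (suc r) i ≡ i + 2
τF-init {r} {i} lt = if-≢ (i + 1) (suc r) λ eq → <⇒≢ lt (suc-injective (trans (+-comm 1 i) eq))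

τF-last : ∀ r → τF (suc r) r ≡ 1
τF-last r = if-≡ (r + 1) (suc r) (+-comm r 1)

τG-init : ∀ {s i} → i < s → τG (suc (suc s)) i ≡ i + 1
τG-init {s} {i} lt = trans
  (if-≢ (i + 2) (suc (suc s)) λ eq → <⇒≢ lt (suc-injective (suc-injective (trans (+-comm 2 i) eq))))
  (if-≢ (i + 1) (suc (suc s)) λ eq → <⇒≢ (m≤n⇒m≤1+n lt) (suc-injective (trans (+-comm 1 i) eq)))

τG-mid : ∀ s → τG (suc (suc s)) s ≡ suc (suc s)
τG-mid s = if-≡ (s + 2) (suc (suc s)) (+-comm s 2)

τG-last : ∀ s → τG (suc (suc s)) (suc s) ≡ suc s
τG-last s = trans
  (if-≢ (suc s + 2) (suc (suc s)) λ eq → <⇒≢ ≤-refl (trans (sym eq) (+-comm (suc s) 2)))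
  (if-≡ (suc s + 1) (suc (suc s)) (+-comm (suc s) 1))

τF-injective : ∀ {r i i′} → i < suc r → i′ < suc r → τF (suc r) i ≡ τF (suc r) i′ → i ≡ i′
τF-injective {r} {i} {i′} lt lt′ eq with <suc-cases lt | <suc-cases lt′
... | inj₁ p | inj₁ q = +-cancelʳ-≡ 2 i i′ (trans (sym (τF-init p)) (trans eq (τF-init q)))
... | inj₁ p | inj₂ refl = contradiction (suc-injective (trans (+-comm 2 i) (trans (sym (τF-init p)) (trans eq (τF-last r))))) λ ()
... | inj₂ refl | inj₁ q = contradiction (suc-injective (trans (+-comm 2 i′) (trans (sym (τF-init q)) (trans (sym eq) (τF-last r))))) λ ()
... | inj₂ refl | inj₂ refl = refl

data Place (s : ℕ) : ℕ → Set where
  init : ∀ {i} → i < s → Place s i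
  mid : Place s s
  last : Place s (suc s)

place : ∀ {s i} → i < suc (suc s) → Place s i
place lt with <suc-cases lt
... | inj₂ refl = last
... | inj₁ lt′ with <suc-cases lt′
...   | inj₁ lt″ = init lt″
...   | inj₂ refl = mid

τG-injective : ∀ {s i i′} → i < suc (suc s) → i′ < suc (suc s) → τG (suc (suc s)) i ≡ τG (suc (suc s)) i′ → i ≡ i′
τG-injective {s} {i} {i′} lt lt′ eq with place lt | place lt′
... | init p | init q = +-cancelʳ-≡ 1 i i′ (trans (sym (τG-init p)) (trans eq (τG-init q)))
... | init p | mid = contradiction (trans (+-comm 1 i) (trans (sym (τG-init p)) (trans eq (τG-mid s)))) (<⇒≢ (s≤s (m≤n⇒m≤1+n p)))
... | init p | last = contradiction (trans (+-comm 1 i) (trans (sym (τG-init p)) (trans eq (τG-last s)))) (<⇒≢ (s≤s p))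
... | mid | init q = contradiction (trans (+-comm 1 i′) (trans (sym (τG-init q)) (trans (sym eq) (τG-mid s)))) (<⇒≢ (s≤s (m≤n⇒m≤1+n q)))
... | last | init q = contradiction (trans (+-comm 1 i′) (trans (sym (τG-init q)) (trans (sym eq) (τG-last s)))) (<⇒≢ (s≤s q))
... | mid | mid = refl
... | last | last = refl
... | mid | last = contradiction (trans (sym (τG-last s)) (trans (sym eq) (τG-mid s))) (<⇒≢ ≤-refl)
... | last | mid = contradiction (trans (sym (τG-last s)) (trans eq (τG-mid s))) (<⇒≢ ≤-refl)


τJ : ℕ → ℕ
τJ i = i + 1

private
  mono-τJ : ∀ {i i′} → i < i′ → τJ i < τJ i′
  mono-τJ lt = +-monoˡ-< 1 lt

suc-of : ∀ {a b} → a < b → ∃[ m ] b ≡ suc m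
suc-of {b = suc m} _ = m , refl

-- Provides the descent between the last two entries of an occurrence of F_k, which is how F_k
-- becomes a condition of the same kind as H_k.
find-drop : ∀ {v : ℕ → ℕ} a {b} → a < b → v b < v a → ∃[ j ] (a ≤ j × j < b × v (suc j) < v j)
find-drop {v} a {suc b} (s≤s a≤b) lt with v (suc b) <? v b
... | yes d = b , a≤b , ≤-refl , d
... | no ≮ with m≤n⇒m<n∨m≡n a≤b
...   | inj₂ refl = contradiction lt ≮
...   | inj₁ a<b with find-drop {v} a a<b (≤-<-trans (≮⇒≥ ≮) lt)
...     | j , p , q , d = j , p , m≤n⇒m≤1+n q , d

-- Occurrences of H_k and Q_k

module _ (κ m : ℕ) (v : ℕ → ℕ) (sep : Sep v (suc m)) where
  private
    s = suc κ
    k = suc (suc s)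

  HasH HasQ : Set
  HasH = ∃[ g ] (Occ τJ k (suc m) v g × ∃[ j ] (v (suc j) < v j × g s ≤ j × j < g (suc s)))
  HasQ = ∃[ g ] (Occ (τG k) k (suc m) v g × (∀ j → g s ≤ j → suc j < g (suc s) → v j < v (suc j)) ×
                 ∃[ p ] (g (suc s) ≡ suc p × v (suc p) < v p))

  Good⇒¬H : Good (rows κ) (pre v (suc m)) → ¬ HasH
  Good⇒¬H good (g , o , j , d , lo , hi) with suc-of hi
  ... | p , eq = proj₁ (Good⇒ (rows κ) m good (≤-pred (subst (_< suc m) eq (bound o ≤-refl))))
    (⇒Frozen (rows κ) (suc (suc p)) (s≤s (subst (j <_) eq hi)) (Drop⇒DescAt (rows κ) d)
      (Pos⇒Has (suc j) (suc s) record
        { pos = g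
        ; pos< = λ lt → s≤s (≤-trans (g≤ lt) lo)
        ; pos-≺ = λ lt lt′ → incr o lt (m≤n⇒m≤1+n lt′) , order o (m≤n⇒m≤1+n (<-trans lt lt′)) (m≤n⇒m≤1+n lt′) (mono-τJ lt)
        ; pos-S = λ {i} lt → subst (λ q → v (g i) < v q) eq (order o (m≤n⇒m≤1+n lt) ≤-refl (mono-τJ lt)) }))
    where
    g≤ : ∀ {i} → i < suc s → g i ≤ g s
    g≤ lt with <suc-cases lt
    ... | inj₁ lt′ = <⇒≤ (incr o lt′ (n≤1+n _))
    ... | inj₂ refl = ≤-refl

  Good⇒¬Q : Good (rows κ) (pre v (suc m)) → ¬ HasQ
  Good⇒¬Q good (g , o , _ , p , eq , d) =
    proj₂ (Good⇒ (rows κ) m good (≤-pred (subst (_< suc m) eq (bound o ≤-refl))))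
      (Drop⇒DescAt (rows κ) {v} {p} d , Pos⇒Has (suc p) s record
        { pos = g
        ; pos< = λ {i} lt → subst (g i <_) eq (incr o (m≤n⇒m≤1+n lt) ≤-refl)
        ; pos-≺ = λ lt lt′ → incr o lt (up lt′) , order o (up (<-trans lt lt′)) (up lt′)
            (subst₂ _<_ (sym (τG-init (<-trans lt lt′))) (sym (τG-init lt′)) (+-monoˡ-< 1 lt))
        ; pos-S = λ {i} lt → subst (λ q → v (g i) < v q) eq (order o (up lt) ≤-refl
            (subst₂ _<_ (sym (trans (τG-init lt) (+-comm i 1))) (sym (τG-last s)) (s≤s lt))) })
    where
    up : ∀ {i} → i < s → i < k
    up lt = m≤n⇒m≤1+n (m≤n⇒m≤1+n lt)

  ¬HQ⇒Good : ¬ HasH → ¬ HasQ → Good (rows κ) (pre v (suc m))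
  ¬HQ⇒Good nh nq = ⇒Good (rows κ) m λ {j} lt → noH lt , noQ lt
    where
    noH : ∀ {j} → j < m → ¬ Frozen (rows κ) (pre v (suc (suc j))) (v (suc j))
    noH {j} lt f with Frozen⇒ (rows κ) (suc (suc j)) f
    ... | j₀ , lt₀ , d , big = nh (g , o , j₀ ,
        DescAt⇒Drop (rows κ) sep (<-≤-trans lt₀ (s≤s lt)) d ,
        ≤-trans (≤-reflexive (splice-< (pos p) ≤-refl)) (≤-pred (pos< p ≤-refl)) ,
        <-≤-trans (≤-pred lt₀) (≤-reflexive (sym (splice-≥ (pos p) {suc s} {suc j} ≤-refl))))
      where
      p = Has⇒Pos (suc j₀) (suc s) big
      g = splice (pos p) (suc s) (suc j)
      in< : ∀ {i} → i < suc s → g i ≡ pos p i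
      in< = splice-< (pos p)
      both : ∀ {i i′} → i < i′ → i′ < k → g i < g i′ × v (g i) < v (g i′)
      both {i} {i′} lt lt′ with <suc-cases lt′
      ... | inj₁ lt″ rewrite in< lt″ | in< (<-trans lt lt″) = pos-≺ p lt lt″
      ... | inj₂ refl rewrite splice-≥ (pos p) {suc s} {suc j} {suc s} ≤-refl | in< lt = <-≤-trans (pos< p lt) (≤-pred lt₀) , pos-S p lt
      o : Occ τJ k (suc m) v g
      o .bound {i} lt′ with <suc-cases lt′
      ... | inj₁ lt″ rewrite in< lt″ = <-trans (<-≤-trans (pos< p lt″) (≤-pred lt₀)) (s≤s lt)
      ... | inj₂ refl rewrite splice-≥ (pos p) {suc s} {suc j} {suc s} ≤-refl = s≤s lt
      o .incr lt lt′ = proj₁ (both lt lt′)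
      o .order {i} {i′} _ lt′ lt = proj₂ (both (+-cancelʳ-< 1 i i′ lt) lt′)
    noQ : ∀ {j} → j < m → ¬ Peak (rows κ) (v (suc j)) (v j) (pre v j)
    -- The last two entries are adjacent, so no position is left between them at which an ascent is
    -- required.
    noQ {j} lt (d , h) = nq (g , o , (λ j′ lo hi → contradiction (≤-trans hi (≤-reflexive g-last)) (≤⇒≯ (s≤s (≤-trans (≤-reflexive (sym g-mid)) lo)))) ,
                             j , g-last , drop)
      where
      drop : v (suc j) < v j
      drop = DescAt⇒Drop (rows κ) sep (s≤s lt) d
      p = Has⇒Pos (suc j) s h
      g = splice (splice (pos p) s j) (suc s) (suc j)
      g-last : g (suc s) ≡ suc j
      g-last = splice-≥ _ ≤-refl
      g-mid : g s ≡ j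
      g-mid = trans (splice-< _ ≤-refl) (splice-≥ _ ≤-refl)
      g-init : ∀ {i} → i < s → g i ≡ pos p i
      g-init lt = trans (splice-< _ (m≤n⇒m≤1+n lt)) (splice-< _ lt)
      -- A chain entry at `j` itself would lie below `v (suc j)`, against the drop.
      pos<j : ∀ {i} → i < s → pos p i < j
      pos<j {i} lt with <suc-cases (pos< p lt)
      ... | inj₁ lt′ = lt′
      ... | inj₂ eq = contradiction (<-trans (pos-S p lt) drop) (<-irrefl (cong v eq))
      o : Occ (τG k) k (suc m) v g
      o .bound lt′ with place lt′
      ... | init q rewrite g-init q = <-trans (pos<j q) (m≤n⇒m≤1+n lt)
      ... | mid rewrite g-mid = m≤n⇒m≤1+n lt
      ... | last rewrite g-last = s≤s lt
      o .incr lt lt′ with place (<-trans lt lt′) | place lt′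
      ... | init q | init q′ rewrite g-init q | g-init q′ = proj₁ (pos-≺ p lt q′)
      ... | init q | mid rewrite g-init q | g-mid = pos<j q
      ... | init q | last rewrite g-init q | g-last = m≤n⇒m≤1+n (pos<j q)
      ... | mid | init q′ = contradiction lt (<-asym q′)
      ... | mid | mid = contradiction lt (n≮n _)
      ... | mid | last rewrite g-mid | g-last = ≤-refl
      ... | last | init q′ = contradiction (<-trans lt q′) (<-asym ≤-refl)
      ... | last | mid = contradiction lt (<-asym ≤-refl)
      ... | last | last = contradiction lt (n≮n _)
      o .order {i} {i′} l l′ lt with place l | place l′
      ... | init q | init q′ rewrite g-init q | g-init q′ =
            proj₂ (pos-≺ p (+-cancelʳ-< 1 i i′ (subst₂ _<_ (τG-init q) (τG-init q′) lt)) q′)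
      ... | init q | mid rewrite g-init q | g-mid = <-trans (pos-S p q) drop
      ... | init q | last rewrite g-init q | g-last = pos-S p q
      ... | mid | init q′ = contradiction (subst₂ _<_ (τG-mid s) (trans (τG-init q′) (+-comm i′ 1)) lt) (<-asym (s≤s (m≤n⇒m≤1+n q′)))
      ... | mid | mid = contradiction lt (n≮n _)
      ... | mid | last = contradiction (subst₂ _<_ (τG-mid s) (τG-last s) lt) (<-asym ≤-refl)
      ... | last | init q′ = contradiction (subst₂ _<_ (τG-last s) (trans (τG-init q′) (+-comm i′ 1)) lt) (<-asym (s≤s q′))
      ... | last | mid rewrite g-mid | g-last = drop
      ... | last | last = contradiction lt (n≮n _)

-- Occurrences of F_k in terms of the complement

module _ (κ m : ℕ) (v u : ℕ → ℕ) (sep : Sep u (suc m))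
         (rev  : ∀ {p q} → p < suc m → q < suc m → v p < v q → u q < u p)
         (rev⁻ : ∀ {p q} → p < suc m → q < suc m → u p < u q → v q < v p) where
  private
    s = suc κ
    k = suc (suc s)

  HasF : Set
  HasF = ∃[ g ] Occ (τF k) k (suc m) v g

  Good⇒¬F : Good (cols κ) (pre u (suc m)) → ¬ HasF
  Good⇒¬F good (g , o) with find-drop {v} (g s) (incr o ≤-refl ≤-refl) (order o ≤-refl (n≤1+n _)
                              (subst₂ _<_ (sym (τF-last (suc s))) (sym (trans (τF-init {suc s} {s} ≤-refl) (+-comm s 2))) (s≤s (s≤s z≤n))))
  ... | j , lo , hi , d with suc-of hi
  ...   | p , eq = proj₁ (Good⇒ (cols κ) m good (≤-pred (subst (_< suc m) eq (bound o ≤-refl))))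
    (⇒Frozen (cols κ) (suc (suc p)) (s≤s (subst (j <_) eq hi))
      (Drop⇒DescAt (cols κ) (rev (≤-<-trans hi (bound o ≤-refl)) (<-trans hi (bound o ≤-refl)) d))
      (Pos⇒Has (suc j) (suc s) record
        { pos = g
        ; pos< = λ lt → s≤s (≤-trans (g≤ lt) lo)
        ; pos-≺ = λ {i} {i′} lt lt′ → incr o lt (m≤n⇒m≤1+n lt′) ,
            rev (bound o (m≤n⇒m≤1+n (<-trans lt lt′))) (bound o (m≤n⇒m≤1+n lt′))
              (order o (m≤n⇒m≤1+n (<-trans lt lt′)) (m≤n⇒m≤1+n lt′)
                (subst₂ _<_ (sym (τF-init (<-trans lt lt′))) (sym (τF-init lt′)) (+-monoˡ-< 2 lt)))
        ; pos-S = λ {i} lt → subst (λ q → u (g i) < u q) eq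
            (rev (bound o ≤-refl) (bound o (m≤n⇒m≤1+n lt)) (order o ≤-refl (m≤n⇒m≤1+n lt)
              (subst₂ _<_ (sym (τF-last (suc s))) (sym (trans (τF-init lt) (+-comm i 2))) (s≤s (s≤s z≤n))))) }))
    where
    g≤ : ∀ {i} → i < suc s → g i ≤ g s
    g≤ lt with <suc-cases lt
    ... | inj₁ lt′ = <⇒≤ (incr o lt′ (n≤1+n _))
    ... | inj₂ refl = ≤-refl

  ¬F⇒Good : ¬ HasF → Good (cols κ) (pre u (suc m))
  ¬F⇒Good nf = ⇒Good (cols κ) m λ lt → noF lt , λ ()
    where
    noF : ∀ {j} → j < m → ¬ Frozen (cols κ) (pre u (suc (suc j))) (u (suc j))
    noF {j} lt f with Frozen⇒ (cols κ) (suc (suc j)) f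
    ... | j₀ , lt₀ , _ , big = nf (g , o)
      where
      p = Has⇒Pos (suc j₀) (suc s) big
      g = splice (pos p) (suc s) (suc j)
      in< : ∀ {i} → i < suc s → g i ≡ pos p i
      in< = splice-< (pos p)
      at-last : g (suc s) ≡ suc j
      at-last = splice-≥ (pos p) ≤-refl
      pos<m : ∀ {i} → i < suc s → pos p i < suc m
      pos<m lt″ = <-trans (<-≤-trans (pos< p lt″) (≤-pred lt₀)) (s≤s lt)
      o : Occ (τF k) k (suc m) v g
      o .bound {i} lt′ with <suc-cases lt′
      ... | inj₁ lt″ rewrite in< lt″ = pos<m lt″
      ... | inj₂ refl rewrite at-last = s≤s lt
      o .incr {i} {i′} l l′ with <suc-cases l′
      ... | inj₁ l″ rewrite in< l″ | in< (<-trans l l″) = proj₁ (pos-≺ p l l″)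
      ... | inj₂ refl rewrite at-last | in< l = <-≤-trans (pos< p l) (≤-pred lt₀)
      o .order {i} {i′} l l′ τ< with <suc-cases l | <suc-cases l′
      ... | inj₁ q | inj₁ q′ rewrite in< q | in< q′ =
            rev⁻ (pos<m q′) (pos<m q) (proj₂ (pos-≺ p (+-cancelʳ-< 2 i i′ (subst₂ _<_ (τF-init q) (τF-init q′) τ<)) q′))
      ... | inj₂ refl | inj₁ q′ rewrite at-last | in< q′ = rev⁻ (pos<m q′) (s≤s lt) (pos-S p q′)
      ... | inj₁ q | inj₂ refl = contradiction (subst₂ _<_ (trans (τF-init q) (+-comm i 2)) (τF-last (suc s)) τ<) (<-asym (s≤s (s≤s z≤n)))
      ... | inj₂ refl | inj₂ refl = contradiction τ< (n≮n _)


-- The bijection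

opaque
  -- The complement turns earlier larger entries into earlier smaller ones, so that one `rank` and
  -- one insertion serve both sides.
  flip : ∀ {n} → Perm n → Perm n
  flip π = π ∘ₚ reverse

  flip-apply : ∀ {n} (π : Perm n) i → flip π ⟨$⟩ʳ i ≡ opposite (π ⟨$⟩ʳ i)
  flip-apply π i = refl

flip-cong : ∀ {n} {π σ : Perm n} → π ≈ₚ σ → flip π ≈ₚ flip σ
flip-cong {π = π} {σ} eq i = trans (flip-apply π i) (trans (cong opposite (eq i)) (sym (flip-apply σ i)))

flip-involutive : ∀ {n} (π : Perm n) → flip (flip π) ≈ₚ π
flip-involutive π i = trans (flip-apply (flip π) i) (trans (cong opposite (flip-apply π i)) (opposite-involutive _))

flip-injective : ∀ {n} {π σ : Perm n} → flip π ≈ₚ flip σ → π ≈ₚ σ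
flip-injective {π = π} {σ} eq i = trans (sym (flip-involutive π i)) (trans (flip-cong {π = flip π} {flip σ} eq i) (flip-involutive σ i))

vals : ∀ {n} → Perm n → ℕ → ℕ
vals π = ext (val π)

vals-Sep : ∀ {n} (π : Perm n) → Sep (vals π) n
vals-Sep π {p} {q} lt q<n eq = <⇒≢ lt (trans (sym (toℕ-fromℕ< p<n)) (trans (cong toℕ same) (toℕ-fromℕ< q<n)))
  where
  p<n = <-trans lt q<n
  same : fromℕ< p<n ≡ fromℕ< q<n
  same = trans (sym (inverseˡ π)) (trans (cong (π ⟨$⟩ˡ_) (toℕ-injective
    (trans (sym (ext-fromℕ< (val π) p<n)) (trans eq (ext-fromℕ< (val π) q<n))))) (inverseˡ π))

vals-flip : ∀ {n} (π : Perm n) {p} → p < n → vals (flip π) p ≡ n ∸ suc (vals π p)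
vals-flip {n} π lt = trans (ext-fromℕ< (val (flip π)) lt)
  (trans (cong toℕ (flip-apply π (fromℕ< lt))) (trans (opposite-prop (π ⟨$⟩ʳ fromℕ< lt)) (cong (λ x → n ∸ suc x) (sym (ext-fromℕ< (val π) lt)))))

flip-rev : ∀ {n} (π : Perm n) {p q} → p < n → q < n → vals π p < vals π q → vals (flip π) q < vals (flip π) p
flip-rev {n} π p<n q<n lt = subst₂ _<_ (sym (vals-flip π q<n)) (sym (vals-flip π p<n))
  (∸-monoʳ-< (s≤s lt) (subst (_< n) (sym (ext-fromℕ< (val π) q<n)) (toℕ<n (π ⟨$⟩ʳ fromℕ< q<n))))

flip-rev⁻ : ∀ {n} (π : Perm n) {p q} → p < n → q < n → vals (flip π) p < vals (flip π) q → vals π q < vals π p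
flip-rev⁻ {n} π p<n q<n lt = ≰⇒> λ le → <⇒≱ (subst₂ _<_ (vals-flip π p<n) (vals-flip π q<n) lt) (∸-monoʳ-≤ n (s≤s le))

Descent⇒ : ∀ {n} {π : Perm n} {j} → Descent π j → suc j < n × vals π (suc j) < vals π j
Descent⇒ {π = π} {j} (p , lt) = p , subst₂ _<_ (sym (ext-fromℕ< (val π) p)) (sym (ext-fromℕ< (val π) (<-trans (n<1+n j) p))) lt

⇒Descent : ∀ {n} {π : Perm n} {j} → suc j < n → vals π (suc j) < vals π j → Descent π j
⇒Descent {π = π} {j} p lt = p , subst₂ _<_ (ext-fromℕ< (val π) p) (ext-fromℕ< (val π) (<-trans (n<1+n j) p)) lt

Ascent⇒ : ∀ {n} {π : Perm n} {j} → Ascent π j → vals π j < vals π (suc j)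
Ascent⇒ {π = π} {j} (p , lt) = subst₂ _<_ (sym (ext-fromℕ< (val π) (<-trans (n<1+n j) p))) (sym (ext-fromℕ< (val π) p)) lt

⇒Ascent : ∀ {n} {π : Perm n} {j} → suc j < n → vals π j < vals π (suc j) → Ascent π j
⇒Ascent {π = π} {j} p lt = p , subst₂ _<_ (ext-fromℕ< (val π) (<-trans (n<1+n j) p)) (ext-fromℕ< (val π) p) lt

module _ (κ m : ℕ) where
  private
    s = suc κ
    k = suc (suc s)
    n = suc m

  module _ (π : Perm n) where
    private
      v = vals π
      u = vals (flip π)

    F⇒HasF : Contains (F k) π → HasF κ m v u (vals-Sep (flip π)) (flip-rev π) (flip-rev⁻ π)
    F⇒HasF (f , o) = ext (toℕ ∘ f) , Occurrence⇒Occ {τF k} {π = π} o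

    HasF⇒F : HasF κ m v u (vals-Sep (flip π)) (flip-rev π) (flip-rev⁻ π) → Contains (F k) π
    HasF⇒F (g , o) with Occ⇒Occurrence {τF k} {π = π} τF-injective o
    ... | f , oc , _ = f , oc

    private
      index : ∀ {f : Fin k → Fin n} {a : Fin k} t {j} → toℕ a + t ≡ j + t → ext (toℕ ∘ f) j ≡ toℕ (f a)
      index {f} {a} t eq = trans (cong (ext (toℕ ∘ f)) (sym (+-cancelʳ-≡ t _ _ eq))) (ext-toℕ (toℕ ∘ f) a)

      a b : Fin k
      a = fromℕ< {s} {k} (m≤n⇒m≤1+n ≤-refl)
      b = fromℕ< {suc s} {k} ≤-refl
      a+2 : toℕ a + 2 ≡ k
      a+2 = trans (cong (_+ 2) (toℕ-fromℕ< {s} {k} (m≤n⇒m≤1+n ≤-refl))) (+-comm s 2)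
      b+1 : toℕ b + 1 ≡ k
      b+1 = trans (cong (_+ 1) (toℕ-fromℕ< {suc s} {k} ≤-refl)) (+-comm (suc s) 1)

    H⇒HasH : ContainsH k π → HasH κ m v (vals-Sep π)
    H⇒HasH (f , o , a , b , ea , eb , j , d , lo , hi) =
      ext (toℕ ∘ f) , Occurrence⇒Occ {τJ} {π = π} o , j , proj₂ (Descent⇒ {π = π} d) ,
      ≤-trans (≤-reflexive (index {f} {a} 2 {s} (trans ea (+-comm 2 s)))) lo ,
      ≤-trans hi (≤-reflexive (sym (index {f} {b} 1 {suc s} (trans eb (+-comm 1 (suc s))))))

    HasH⇒H : HasH κ m v (vals-Sep π) → ContainsH k π
    HasH⇒H (g , o , j , d , lo , hi) with Occ⇒Occurrence {τJ} {π = π} (λ {i} {i′} _ _ → +-cancelʳ-≡ 1 i i′) o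
    ... | f , oc , fa = f , oc , a , b , a+2 , b+1 , j ,
      ⇒Descent {π = π} (≤-<-trans hi (bound o ≤-refl)) d ,
      ≤-trans (≤-reflexive (trans (fa a) (cong g (toℕ-fromℕ< {s} {k} (m≤n⇒m≤1+n ≤-refl))))) lo ,
      ≤-trans hi (≤-reflexive (sym (trans (fa b) (cong g (toℕ-fromℕ< {suc s} {k} ≤-refl)))))

    Q⇒HasQ : ContainsQ k π → HasQ κ m v (vals-Sep π)
    Q⇒HasQ (f , oc , a , b , ea , eb , climb , desc) with Occurrence⇒Occ {τG k} {π = π} oc
    ... | o with suc-of (incr o {s} ≤-refl ≤-refl)
    ...   | p , eq = ext (toℕ ∘ f) , o ,
      (λ j lo hi → Ascent⇒ {π = π} (climb j (≤-trans (≤-reflexive (sym fa)) lo) (≤-trans hi (≤-reflexive fb)))) ,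
      p , eq , proj₂ (Descent⇒ {π = π} (subst (Descent π) (cong (_∸ 1) (trans (sym fb) eq)) desc))
      where
      fa = index {f} {a} 2 {s} (trans ea (+-comm 2 s))
      fb = index {f} {b} 1 {suc s} (trans eb (+-comm 1 (suc s)))

    HasQ⇒Q : HasQ κ m v (vals-Sep π) → ContainsQ k π
    HasQ⇒Q (g , o , climb , p , eq , d) with Occ⇒Occurrence {τG k} {π = π} τG-injective o
    ... | f , oc , fa = f , oc , a , b , a+2 , b+1 ,
      (λ j lo hi → ⇒Ascent {π = π} (<-trans hi (toℕ<n (f b))) (climb j (≤-trans (≤-reflexive (sym ga)) lo) (≤-trans hi (≤-reflexive gb)))) ,
      subst (Descent π) (cong (_∸ 1) (sym (trans gb eq))) (⇒Descent {π = π} (subst (_< n) eq (bound o ≤-refl)) d)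
      where
      ga = trans (fa a) (cong g (toℕ-fromℕ< {s} {k} (m≤n⇒m≤1+n ≤-refl)))
      gb = trans (fa b) (cong g (toℕ-fromℕ< {suc s} {k} ≤-refl))

    word≡ : word (val π) ≡ pre v n
    word≡ = word≡pre (val π) v (ext-toℕ (val π))

    AvoidsHQ⇒Good : AvoidsH k π → AvoidsQ k π → Good (rows κ) (word (val π))
    AvoidsHQ⇒Good nh nq = subst (Good (rows κ)) (sym word≡) (¬HQ⇒Good κ m v (vals-Sep π) (nh ∘ HasH⇒H) (nq ∘ HasQ⇒Q))

    Good⇒AvoidsHQ : Good (rows κ) (word (val π)) → AvoidsH k π × AvoidsQ k π
    Good⇒AvoidsHQ g = Good⇒¬H κ m v (vals-Sep π) g′ ∘ H⇒HasH , Good⇒¬Q κ m v (vals-Sep π) g′ ∘ Q⇒HasQ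
      where g′ = subst (Good (rows κ)) word≡ g

    Distinct-word : Distinct (word (val π))
    Distinct-word = subst Distinct (sym word≡) (Sep-pre (vals-Sep π) n ≤-refl)

  module _ (π : Perm n) where
    AvoidsF⇒Good : Avoids (F k) π → Good (cols κ) (word (val (flip π)))
    AvoidsF⇒Good nf = subst (Good (cols κ)) (sym (word≡ (flip π)))
      (¬F⇒Good κ m (vals π) (vals (flip π)) (vals-Sep (flip π)) (flip-rev π) (flip-rev⁻ π) (nf ∘ HasF⇒F π))

    Good⇒AvoidsF : Good (cols κ) (word (val (flip π))) → Avoids (F k) π
    Good⇒AvoidsF g = Good⇒¬F κ m (vals π) (vals (flip π)) (vals-Sep (flip π)) (flip-rev π) (flip-rev⁻ π)
      (subst (Good (cols κ)) (word≡ (flip π)) g) ∘ F⇒HasF π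

mirror : List ℕ → List ℕ
mirror w = skew w []

mirror-Conj : ∀ {w} → Yam w → Yam (mirror w) × Conj w (mirror w) × w ≡ mirror (mirror w)
mirror-Conj {w} y with skew-Conj w {[]} {[]} (subst Yam (sym (++-identityʳ w)) y) [] Conj-[]
... | y′ , κ , eq = subst Yam (++-identityʳ (skew w [])) y′ ,
                    subst₂ Conj (++-identityʳ w) (++-identityʳ (skew w [])) κ , eq

headCode : ∀ {m} → Perm (suc m) → ℕ
headCode {m} π = rank (word (val π ∘ inject₁)) (val π (fromℕ m))

tailCode : ∀ {m} → Perm (suc m) → List ℕ
tailCode π = codes (word (val π ∘ inject₁))

Joint-length : ∀ {X Y e es R ρ d ds C γ} → Joint X Y e es R ρ d ds C γ → length es ≡ length ds
Joint-length start = refl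
Joint-length (asc J _ _ _ _ _ _) = cong suc (Joint-length J)
Joint-length (small J _ _ _ _ _ _ _ _) = cong suc (Joint-length J)
Joint-length (cut _ _ J _ _ _ _ _ _ _ _ _ _ _ _ _ _) = cong suc (Joint-length J)

codes-length : ∀ us → length (codes us) ≡ length us
codes-length [] = refl
codes-length (x ∷ us) = cong suc (codes-length us)

word-length : ∀ {n} (v : Fin n → ℕ) → length (word v) ≡ n
word-length {zero} v = refl
word-length {suc n} v = cong suc (word-length (v ∘ inject₁))

tailCode-length : ∀ {m} (π : Perm (suc m)) → length (tailCode π) ≡ m
tailCode-length π = trans (codes-length (word (val π ∘ inject₁))) (word-length (val π ∘ inject₁))

decode-Run : ∀ {X m e es R ρ} → length es ≡ m → Run X e es R ρ → ∃[ π ] (headCode {m} π ≡ e × tailCode π ≡ es)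
decode-Run {m = m} {e} {es} len r with decode {suc m} {e ∷ es} (cong suc len) (Run-Lehmer r)
... | π , eq = π , ∷-injective {x = headCode π} {tailCode π} {e} {es} eq

-- A step of a joint run is an ascent on both sides or a descent on both; an ascent on the first
-- side rules out the given descent.
Joint-desc : ∀ {X Y e es R ρ d ds C γ} → Joint X Y e es R ρ d ds C γ → ∀ m u w →
             e ≡ rank (pre u m) (u m) → es ≡ codes (pre u m) → d ≡ rank (pre w m) (w m) → ds ≡ codes (pre w m) →
             ∀ {j} → j < m → DescAt X u j → DescAt Y w j
Joint-desc {X} (asc J a _ _ _ _ _) (suc m) u w refl refl refl refl lt δ with <suc-cases lt
... | inj₁ lt′ = Joint-desc J m u w refl refl refl refl lt′ δ
... | inj₂ refl = ⊥-elim (asc-desc X a δ)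
Joint-desc (small J _ b _ _ _ _ _ _) (suc m) u w refl refl refl refl lt δ with <suc-cases lt
... | inj₁ lt′ = Joint-desc J m u w refl refl refl refl lt′ δ
... | inj₂ refl = b
Joint-desc (cut _ _ J _ b _ _ _ _ _ _ _ _ _ _ _ _) (suc m) u w refl refl refl refl lt δ with <suc-cases lt
... | inj₁ lt′ = Joint-desc J m u w refl refl refl refl lt′ δ
... | inj₂ refl = b

module _ (κ m : ℕ) where
  private
    k = suc (suc (suc κ))

  -- The bijection as a relation: the final tableaux are transposes of each other and the runs share
  -- cells and cut pieces. Since this is symmetric in the two sides, the map and its inverse are
  -- treated alike.
  Link : Perm (suc m) → Perm (suc m) → Set
  Link π σ = ∃[ C ] ∃[ γ ] ∃[ ρ ]
    Joint (cols κ) (rows κ) (headCode (flip π)) (tailCode (flip π)) C γ (headCode σ) (tailCode σ) (mirror C) ρ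

  opaque
    link→ : (π : Perm (suc m)) → Avoids (F k) π → ∃[ σ ] Link π σ
    link→ π h with Good-Run (cols κ) (Distinct-word κ m (flip π)) (AvoidsF⇒Good κ m π h)
    ... | C , γ , r with mirror-Conj (Run-Yam r)
    ...   | y , cj , _ with transpose (cols κ) r y cj
    ...     | e , es , ρ , J with decode-Run (trans (sym (Joint-length J)) (tailCode-length (flip π))) (Joint-Run (Joint-sym J))
    ...       | σ , refl , refl = σ , C , γ , ρ , J

  opaque
    link← : (σ : Perm (suc m)) → AvoidsH k σ → AvoidsQ k σ → ∃[ π ] Link π σ
    link← σ nh nq with Good-Run (rows κ) (Distinct-word κ m σ) (AvoidsHQ⇒Good κ m σ nh nq)
    ... | R , ρ , r with mirror-Conj (Run-Yam r)
    ...   | y , cj , inv with transpose (rows κ) r y cj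
    ...     | d , ds , γ , J with decode-Run (trans (sym (Joint-length J)) (tailCode-length σ)) (Joint-Run (Joint-sym J))
    ...       | π , p , q = flip π , mirror R , γ , ρ ,
      subst (λ R′ → Joint (cols κ) (rows κ) (headCode (flip (flip π))) (tailCode (flip (flip π))) (mirror R) γ (headCode σ) (tailCode σ) R′ ρ) inv
        (subst₂ (λ d ds → Joint (cols κ) (rows κ) d ds (mirror R) γ (headCode σ) (tailCode σ) R ρ)
          (trans (sym p) (proj₁ same)) (trans (sym q) (proj₂ same)) (Joint-sym J))
      where
      same : headCode π ≡ headCode (flip (flip π)) × tailCode π ≡ tailCode (flip (flip π))
      same = ∷-injective (code-cong {π = π} {flip (flip π)} λ i → sym (flip-involutive π i))

  link-avoids→ : ∀ {π σ} → Link π σ → AvoidsH k σ × AvoidsQ k σ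
  link-avoids→ {π} {σ} (_ , _ , _ , J) =
    Good⇒AvoidsHQ κ m σ (Run-Good (rows κ) (Distinct-word κ m σ) (Joint-Run (Joint-sym J)) refl refl)

  link-avoids← : ∀ {π σ} → Link π σ → Avoids (F k) π
  link-avoids← {π} {σ} (_ , _ , _ , J) =
    Good⇒AvoidsF κ m π (Run-Good (cols κ) (Distinct-word κ m (flip π)) (Joint-Run J) refl refl)

  -- Equal permutations have equal codes, hence the same final tableau and the same transpose, and
  -- `Joint-unique` applies. With equal arguments it also shows that the image does not depend on
  -- the proof of avoidance.
  link-functional : ∀ {π π′ σ σ′} → Link π σ → Link π′ σ′ → π ≈ₚ π′ → σ ≈ₚ σ′
  link-functional {π} {π′} {σ} {σ′} (C , γ , ρ , J) (C′ , γ′ , ρ′ , J′) eq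
    with ∷-injective (code-cong {π = flip π} {flip π′} (flip-cong {π = π} {π′} eq))
  ... | p , q with subst₂ (λ d ds → Joint (cols κ) (rows κ) d ds C γ (headCode σ) (tailCode σ) (mirror C) ρ) p q J
  ...   | J₁ with Run-functional (Joint-Run J₁) (Joint-Run J′)
  ...     | refl , _ with Joint-unique J₁ J′
  ...       | p′ , q′ = code-injective σ σ′ (cong₂ _∷_ p′ q′)

  link-injective : ∀ {π π′ σ σ′} → Link π σ → Link π′ σ′ → σ ≈ₚ σ′ → π ≈ₚ π′
  link-injective {π} {π′} {σ} {σ′} (C , γ , ρ , J) (C′ , γ′ , ρ′ , J′) eq
    with ∷-injective (code-cong {π = σ} {σ′} eq)
  ... | p , q with subst₂ (λ e es → Joint (cols κ) (rows κ) (headCode (flip π)) (tailCode (flip π)) C γ e es (mirror C) ρ) p q J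
  ...   | J₁ with Run-functional (Joint-Run (Joint-sym J₁)) (Joint-Run (Joint-sym J′))
  -- Transposing is an involution, so equal transposes come from equal tableaux.
  ...     | same , _ with trans (proj₂ (proj₂ (mirror-Conj (Run-Yam (Joint-Run J₁)))))
                          (trans (cong mirror same) (sym (proj₂ (proj₂ (mirror-Conj (Run-Yam (Joint-Run J′)))))))
  ...       | refl with Joint-unique (Joint-sym J₁) (Joint-sym J′)
  ...         | p′ , q′ = flip-injective {π = π} {π′} (code-injective (flip π) (flip π′) (cong₂ _∷_ p′ q′))

  link-descents : ∀ {π σ} → Link π σ → ∀ j → Descent π j ⇔ Descent σ j
  link-descents {π} {σ} (_ , _ , _ , J) j = mk⇔ to from
    where
    code≡ : ∀ (π : Perm (suc m)) → headCode π ≡ rank (pre (vals π) m) (vals π m) × tailCode π ≡ codes (pre (vals π) m)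
    code≡ π = ∷-injective (cong codes (word≡ κ m π))
    to : Descent π j → Descent σ j
    to δ with Descent⇒ {π = π} δ
    ... | lt , d = ⇒Descent {π = σ} lt (DescAt⇒Drop (rows κ) (vals-Sep σ) lt
      (Joint-desc J m (vals (flip π)) (vals σ) (proj₁ (code≡ (flip π))) (proj₂ (code≡ (flip π))) (proj₁ (code≡ σ)) (proj₂ (code≡ σ))
        (≤-pred lt) (Drop⇒DescAt (cols κ) (flip-rev π lt (<-trans ≤-refl lt) d))))
    from : Descent σ j → Descent π j
    from δ with Descent⇒ {π = σ} δ
    ... | lt , d = ⇒Descent {π = π} lt (flip-rev⁻ π (<-trans ≤-refl lt) lt (DescAt⇒Drop (cols κ) (vals-Sep (flip π)) lt
      (Joint-desc (Joint-sym J) m (vals σ) (vals (flip π)) (proj₁ (code≡ σ)) (proj₂ (code≡ σ)) (proj₁ (code≡ (flip π))) (proj₂ (code≡ (flip π)))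
        (≤-pred lt) (Drop⇒DescAt (rows κ) d))))

  link-surjective : (σ : Perm (suc m)) → AvoidsH k σ → AvoidsQ k σ →
                    ∃[ π ] Σ (Avoids (F k) π) λ h → proj₁ (link→ π h) ≈ₚ σ
  link-surjective σ nh nq = π , h ,
    link-functional {π} {π} {proj₁ (link→ π h)} {σ} (proj₂ (link→ π h)) l (λ _ → refl)
    where
    π : Perm (suc m)
    π = proj₁ (link← σ nh nq)
    l : Link π σ
    l = proj₂ (link← σ nh nq)
    h : Avoids (F k) π
    h = link-avoids← {π} {σ} l

theorem3 : (k n : ℕ) → 3 ≤ k → 1 ≤ n →
    Σ ((π : Perm n) → Avoids (F k) π → Perm n) λ Φ →
    ((π : Perm n) (h : Avoids (F k) π) → AvoidsH k (Φ π h) × AvoidsQ k (Φ π h)) ×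
    ((π π′ : Perm n) (h : Avoids (F k) π) (h′ : Avoids (F k) π′) → π ≈ₚ π′ → Φ π h ≈ₚ Φ π′ h′) ×
    ((π π′ : Perm n) (h : Avoids (F k) π) (h′ : Avoids (F k) π′) → Φ π h ≈ₚ Φ π′ h′ → π ≈ₚ π′) ×
    ((σ : Perm n) → AvoidsH k σ → AvoidsQ k σ → ∃[ π ] Σ (Avoids (F k) π) λ h → Φ π h ≈ₚ σ) ×
    ((π : Perm n) (h : Avoids (F k) π) → ∀ j → Descent π j ⇔ Descent (Φ π h) j)
theorem3 (suc (suc (suc κ))) (suc m) (s≤s (s≤s (s≤s z≤n))) (s≤s z≤n) =
  (λ π h → proj₁ (link→ κ m π h)) ,
  (λ π h → link-avoids→ κ m {π} {proj₁ (link→ κ m π h)} (proj₂ (link→ κ m π h))) ,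
  (λ π π′ h h′ → link-functional κ m {π} {π′} {proj₁ (link→ κ m π h)} {proj₁ (link→ κ m π′ h′)}
                   (proj₂ (link→ κ m π h)) (proj₂ (link→ κ m π′ h′))) ,
  (λ π π′ h h′ → link-injective κ m {π} {π′} {proj₁ (link→ κ m π h)} {proj₁ (link→ κ m π′ h′)}
                   (proj₂ (link→ κ m π h)) (proj₂ (link→ κ m π′ h′))) ,
  link-surjective κ m ,
  (λ π h → link-descents κ m {π} {proj₁ (link→ κ m π h)} (proj₂ (link→ κ m π h)))
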